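{- Let $n$ be a positive integer and let $c,d$ be positive integers with $\gcd(c,d)=1$ and $0<\frac{c}{d}<n$. Let \[\Delta_{\frac{c}{d},n}=\{(x_1,\dots,x_n)\in\mathbb R^n \mid x_1+\cdots+x_n=\tfrac{c}{d},\ 0\le x_i\le 1 \text{ for all } i\},\] so that $d\Delta_{\frac{c}{d},n}=\{x\in\mathbb R^n\mid \sum_i x_i=c,\ 0\le x_i\le d\}$ is a lattice polytope of dimension $n-1$. Then the normalized volume of $d\Delta_{\frac{c}{d},n}$ equals $\left\langle {dn-1 \atop c-1}\right\rangle_d$, i.e. the number of circular permutations of $\{0,1,\dots,dn-1\}$ having exactly $c$ cyclic descents that are fixed under the operation of adding $n$ modulo $dn$ to each entry.
   Context: Normalized volume: for a polytope contained in a hyperplane $\{x\in\mathbb R^n\mid \sum_i x_i=\text{const}\}$, its $(n-1)$-dimensional volume normalized so that the standard simplex $\{x\mid \sum_i x_i=1,\ x_i\ge 0\}$ has volume $1$ (equivalently, $(n-1)!$ times the Euclidean volume measured relative to the lattice $\mathbb Z^n$ intersected with the hyperplane direction). A circular permutation of $\{0,1,\dots,M\}$ is a word $a_0a_1\cdots a_M$ using each element exactly once, considered up to cyclic rotation; its number of cyclic descents is the number of indices $i\in\{0,\dots,M\}$ with $a_i>a_{i+1}$, indices taken modulo $M+1$ (this is invariant under rotation). For $d\mid M+1$, the refined Eulerian number $\left\langle {M \atop k}\right\rangle_d$ is the number of circular permutations of $\{0,\dots,M\}$ with exactly $k+1$ cyclic descents which, as circular permutations, are unchanged when $\frac{M+1}{d}$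 is added modulo $M+1$ to every entry. (For $d=1$ this is the Eulerian number, the number of permutations of $\{1,\dots,M\}$ with $k$ descents.) -}

module Defs where

open import Data.Bool using (Bool; true; false; if_then_else_; _∧_; _∨_)
open import Data.Nat as ℕ using (ℕ; zero; suc; _+_; _*_; _∸_; _^_; _<ᵇ_; _≡ᵇ_; NonZero)
open import Data.Nat.DivMod using (_/_; _%_)
open import Data.Nat.Base using (_!)
open import Data.Nat.ListAction using (sum)
open import Data.List using (List; []; _∷_; _++_; [_]; map; concatMap; length; filterᵇ; upTo; drop; take)
open import Data.Bool.ListAction using (any)
open import Data.Nat.Properties using (m^n≢0)
open import Data.List.Properties using (≡-dec)
open import Data.Integer using (ℤ; +_)
open import Data.Rational using (ℚ; 0ℚ; _-_; ∣_∣; _≤_; _<_)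
import Data.Rational as ℚ
open import Data.Product using (Σ; ∃-syntax)
open import Relation.Nullary.Decidable using (⌊_⌋)

box : ℕ → ℕ → List (List ℕ)
box zero    b = [] ∷ []
box (suc n) b = concatMap (λ x → map (x ∷_) (box n b)) (upTo (suc b))

pointsCount : (n s b : ℕ) → ℕ
pointsCount n s b = length (filterᵇ (λ v → sum v ≡ᵇ s) (box n b))

-- number of lattice points in t·(d Δ_{c/d,n}) = {x | Σ x_i = t c, 0 ≤ x_i ≤ t d}
dilateCount : (n c d t : ℕ) → ℕ
dilateCount n c d t = pointsCount n (t * c) (t * d)

-- Normalized (n-1)-dimensional volume of P = d Δ_{c/d,n} ⊂ {Σ x_i = c}, defined
-- as the Jordan-content limit of lattice-point counts of the dilates:
--   vol P = lim_{t→∞} (n-1)! · #(tP ∩ ℤ^n) / t^(n-1).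
-- (Normalization: for the standard simplex this limit is 1.)
IsNormalizedVolume : (n c d : ℕ) → ℚ → Set
IsNormalizedVolume n c d V =
  ∀ (ε : ℚ) → 0ℚ < ε →
    ∃[ T ] ∀ (t : ℕ) → T ℕ.≤ t →
      ∣ ((+ ((n ∸ 1) ! ℕ.* dilateCount n c d (suc t))) ℚ./ (suc t ^ (n ∸ 1))) {{m^n≢0 (suc t) (n ∸ 1)}} - V ∣ ≤ ε

insertions : ℕ → List ℕ → List (List ℕ)
insertions x []       = (x ∷ []) ∷ []
insertions x (y ∷ ys) = (x ∷ y ∷ ys) ∷ map (y ∷_) (insertions x ys)

perms : List ℕ → List (List ℕ)
perms []       = [] ∷ []
perms (x ∷ xs) = concatMap (insertions x) (perms xs)

-- circular permutations of {0,…,M}: each rotation class is represented by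
-- its unique rotation starting with 0
circPerms : ℕ → List (List ℕ)
circPerms M = map (0 ∷_) (perms (map suc (upTo M)))

linDes : List ℕ → ℕ
linDes (x ∷ y ∷ r) = (if y <ᵇ x then 1 else 0) + linDes (y ∷ r)
linDes _           = 0

cycDes : List ℕ → ℕ
cycDes []      = 0
cycDes (x ∷ r) = linDes ((x ∷ r) ++ [ x ])

rotate : ℕ → List ℕ → List ℕ
rotate k w = drop k w ++ take k w

_==ᴸ_ : List ℕ → List ℕ → Bool
u ==ᴸ w = ⌊ ≡-dec ℕ._≟_ u w ⌋

sameCirc : List ℕ → List ℕ → Bool
sameCirc u w = any (λ k → rotate k w ==ᴸ u) (upTo (length w))

shiftWord : (s m : ℕ) → .{{NonZero m}} → List ℕ → List ℕ
shiftWord s m w = map (λ a → (a + s) % m) w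

refinedEulerian : (M k d : ℕ) → .{{NonZero d}} → ℕ
refinedEulerian M k d =
  length (filterᵇ (λ w → (cycDes w ≡ᵇ suc k) ∧ sameCirc (shiftWord (suc M / d) (suc M) w) w)
                  (circPerms M))

-- Let n = m + 1. Write the partial sums of a lattice point x of the t-th dilate as p_i = r_i + q_i t with 0 ≤ r_i < t. The
-- inequalities 0 ≤ x_i ≤ t d only involve the q_i and the relative order of the r_i, so each admissible pair of a sequence q
-- and an order type of r_1, …, r_m contributes C(t-1, m) points with distinct nonzero r_i. The points with a coincidence
-- among the r_i number O(t^(m-1)), hence the normalized volume is the number of admissible pairs.
--
-- With N = d n, a circular permutation with c cyclic descents lifts to a sequence W with W 0 = 0, steps in [0, N) and
-- W (i + N) = W i + c N, and a lift is determined by its residues modulo N. Since c is invertible modulo d, the permutation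
-- is fixed by adding n exactly when W (i + n) = W i + c n and W 0, …, W m are distinct modulo n. So the base-n digits
-- of W 1, …, W m form an admissible pair, and every admissible pair arises in this way.
module Submission where

open import Defs
open import Data.Bool using (true; false; T; T?; if_then_else_; _∧_)
open import Data.Bool.Properties using (T-∧)
open import Data.List using (List; []; _∷_; _++_; [_]; map; concatMap; length; filter; filterᵇ; upTo; applyUpTo; drop; take; cartesianProduct)
open import Data.List.Membership.Propositional using (_∈_; _∉_; find; lose)
open import Data.List.Membership.Propositional.Properties
open import Data.List.Properties using (length-map; length-++; length-upTo; length-applyUpTo; map-applyUpTo; map-upTo; map-∘; map-concatMap; concatMap-map; concatMap-cong; filter-++; filter-all; filter-reject; ∷-injectiveˡ; ∷-injectiveʳ; ≡-dec; length-drop; ++-assoc; map-++)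
open import Data.List.Relation.Binary.Permutation.Propositional using (_↭_; ↭-refl; ↭-sym; ↭-trans; prep; ↭⇒↭ₛ)
open import Data.List.Relation.Binary.Permutation.Propositional.Properties using (∈-resp-↭; ↭-length; ↭-empty-inv; drop-∷; shift)
open import Data.List.Relation.Unary.All as All using (All; []; _∷_)
open import Data.List.Relation.Unary.AllPairs as AllPairs using (AllPairs; []; _∷_)
open import Data.List.Relation.Unary.Any using (here; there; any?)
open import Data.List.Relation.Unary.Unique.Propositional using (Unique)
import Data.List.Relation.Unary.All.Properties as All
import Data.List.Relation.Unary.Any.Properties as Any
import Data.List.Relation.Unary.AllPairs.Properties as AllPairs
import Data.List.Relation.Unary.Unique.Propositional.Properties as Unique
import Data.List.Relation.Binary.Permutation.Setoid.Properties as ↭ₛ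
open import Data.Nat
open import Data.Nat.ListAction using (sum)
open import Data.Nat.Coprimality using (Coprime; gcd≡1⇒coprime; coprime-Bézout)
open import Data.Nat.Divisibility using (divides)
open import Data.Nat.DivMod
open import Data.Nat.GCD using (gcd; module Bézout)
open import Data.Nat.Properties
open import Data.Nat.Tactic.RingSolver using (solve-∀)
open import Data.Product using (∃; ∃₂; _×_; _,_; proj₁; proj₂)
open import Data.Sum using (_⊎_; inj₁; inj₂)
open import Data.Unit using (tt)
open import Function using (_∘_; id; _⇔_; mk⇔; Equivalence)
open import Relation.Binary.PropositionalEquality hiding ([_])
open import Relation.Nullary using (¬_; yes; no; ¬?; contradiction)
open import Relation.Nullary.Decidable using (toWitness; fromWitness; _×-dec_)
open import Relation.Unary using (Decidable)
import Algebra.Properties.AbelianGroup as AbelianGroup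
import Algebra.Properties.Group as Group
import Data.Integer as ℤ
import Data.Integer.Properties as ℤ
import Data.Rational as ℚ
import Data.Rational.Properties as ℚ
import Data.Rational.Unnormalised as ℚᵘ
import Data.Rational.Unnormalised.Properties as ℚᵘ

-- Counting by injections

-- One encoding serves both halves. Restricted to 0, ..., n, a lift W starts at 0, ends at c n and
-- has steps at most d n = N, so its values are the partial sums of a lattice point of the n-th
-- dilate. The digits of W are taken in base n, those of a general lattice point of the t-th dilate
-- in base t.
--
-- Two obstacles shape the way back from a pair to a circular permutation. The polytope admits steps
-- equal to d n, whereas a lift needs steps below N; and the letters must differ modulo N, whereas
-- the digits r only separate positions modulo n. Both are overcome by the inverse of c modulo d.
-- Each block of n positions raises W by c n, so d consecutive blocks run through all multiples of n
-- modulo N. Hence W i ≡ W j modulo N forces i ≡ j modulo N, and a step of exactly N would identify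
-- two neighbouring positions.
--
-- For the volume no exact count of lattice points is needed: injections in both directions give two
-- inequalities whose difference has an explicit bound.

private
  variable
    A B : Set
    xs ys : List ℕ

unique⊆⇒length≤ : {xs ys : List A} → Unique xs → (∀ {x} → x ∈ xs → x ∈ ys) → length xs ≤ length ys
unique⊆⇒length≤ {xs = []} _ _ = z≤n
unique⊆⇒length≤ {xs = x ∷ xs} (x∉ ∷ u) sub with ∈-∃++ (sub (here refl))
... | as , bs , refl = subst (suc (length xs) ≤_)
        (sym (trans (length-++ as) (trans (+-suc (length as) (length bs)) (cong suc (sym (length-++ as))))))
        (s≤s (unique⊆⇒length≤ u rest))
  where
  rest : ∀ {y} → y ∈ xs → y ∈ as ++ bs
  rest y∈ with ∈-++⁻ as (sub (there y∈))
  ... | inj₁ p = ∈-++⁺ˡ p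
  ... | inj₂ (here refl) = contradiction refl (All.lookup x∉ y∈)
  ... | inj₂ (there q) = ∈-++⁺ʳ as q

unique-map : (f : A → B) {xs : List A} → Unique xs →
  (∀ {x y} → x ∈ xs → y ∈ xs → f x ≡ f y → x ≡ y) → Unique (map f xs)
unique-map f [] inj = []
unique-map f (x∉ ∷ u) inj =
  All.map⁺ (All.tabulate λ y∈ eq → All.lookup x∉ y∈ (inj (here refl) (there y∈) eq))
  ∷ unique-map f u λ p q → inj (there p) (there q)

injection⇒length≤ : (f : A → B) {xs : List A} {ys : List B} → Unique xs → (∀ {x} → x ∈ xs → f x ∈ ys) →
  (∀ {x y} → x ∈ xs → y ∈ xs → f x ≡ f y → x ≡ y) → length xs ≤ length ys
injection⇒length≤ f {xs} {ys} u sub inj = subst (_≤ length ys) (length-map f xs)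
  (unique⊆⇒length≤ (unique-map f u inj) λ y∈ → let _ , x∈ , eq = ∈-map⁻ f y∈ in subst (_∈ ys) (sym eq) (sub x∈))

∈-concatMap-intro : (f : A → List B) {xs : List A} {x : A} {y : B} → x ∈ xs → y ∈ f x → y ∈ concatMap f xs
∈-concatMap-intro f x∈ y∈ = ∈-concatMap⁺ f (lose x∈ y∈)

∈-concatMap-elim : (f : A → List B) {xs : List A} {y : B} → y ∈ concatMap f xs → ∃ λ x → x ∈ xs × y ∈ f x
∈-concatMap-elim f y∈ = find (∈-concatMap⁻ f y∈)

unique-concatMap : (f : A → List B) {xs : List A} → Unique xs → (∀ {x} → x ∈ xs → Unique (f x)) →
  (∀ {x x′ y} → x ∈ xs → x′ ∈ xs → y ∈ f x → y ∈ f x′ → x ≡ x′) → Unique (concatMap f xs)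
unique-concatMap f [] _ _ = []
unique-concatMap f (x∉ ∷ u) uf dis = Unique.++⁺ (uf (here refl))
  (unique-concatMap f u (uf ∘ there) λ p q → dis (there p) (there q))
  λ (y∈ , y∈′) → let x′ , x′∈ , y∈fx′ = ∈-concatMap-elim f y∈′ in
    All.lookup x∉ x′∈ (dis (here refl) (there x′∈) y∈ y∈fx′)

length-concatMap : (f : A → List B) (xs : List A) {k : ℕ} → (∀ {x} → x ∈ xs → length (f x) ≡ k) →
  length (concatMap f xs) ≡ length xs * k
length-concatMap f [] _ = refl
length-concatMap f (x ∷ xs) h = trans (length-++ (f x)) (cong₂ _+_ (h (here refl)) (length-concatMap f xs (h ∘ there)))

length-cartesianProduct : (xs : List A) (ys : List B) → length (cartesianProduct xs ys) ≡ length xs * length ys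
length-cartesianProduct [] ys = refl
length-cartesianProduct (x ∷ xs) ys = trans (length-++ (map (x ,_) ys)) (cong₂ _+_ (length-map _ ys) (length-cartesianProduct xs ys))

length-filter-¬? : {P : A → Set} (P? : Decidable P) (xs : List A) →
  length (filter P? xs) + length (filter (¬? ∘ P?) xs) ≡ length xs
length-filter-¬? P? [] = refl
length-filter-¬? P? (x ∷ xs) with P? x
... | yes _ = cong suc (length-filter-¬? P? xs)
... | no _ = trans (+-suc _ _) (cong suc (length-filter-¬? P? xs))

filter-map : {P : B → Set} (P? : Decidable P) {Q : A → Set} (Q? : Decidable Q) (f : A → B) (xs : List A) →
  (∀ x → P (f x) ⇔ Q x) → length (filter P? (map f xs)) ≡ length (filter Q? xs)
filter-map P? Q? f [] h = refl
filter-map P? Q? f (x ∷ xs) h with P? (f x) | Q? x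
... | yes _ | yes _ = cong suc (filter-map P? Q? f xs h)
... | no _ | no _ = filter-map P? Q? f xs h
... | yes p | no ¬q = contradiction (Equivalence.to (h x) p) ¬q
... | no ¬p | yes q = contradiction (Equivalence.from (h x) q) ¬p

-- Junk value: positions beyond the end of the list read as 0.
at : List ℕ → ℕ → ℕ
at [] _ = 0
at (x ∷ _) zero = x
at (_ ∷ xs) (suc i) = at xs i

at-applyUpTo : ∀ f {k i} → i < k → at (applyUpTo f k) i ≡ f i
at-applyUpTo f {suc k} {zero} _ = refl
at-applyUpTo f {suc k} {suc i} (s≤s p) = at-applyUpTo (f ∘ suc) p

at-beyond : ∀ xs {i} → length xs ≤ i → at xs i ≡ 0
at-beyond [] _ = refl
at-beyond (x ∷ xs) (s≤s p) = at-beyond xs p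

at-ext : length xs ≡ length ys → (∀ {i} → i < length xs → at xs i ≡ at ys i) → xs ≡ ys
at-ext {[]} {[]} _ _ = refl
at-ext {x ∷ xs} {y ∷ ys} l h = cong₂ _∷_ (h z<s) (at-ext (suc-injective l) (h ∘ s<s))

at-++ˡ : ∀ xs {ys i} → i < length xs → at (xs ++ ys) i ≡ at xs i
at-++ˡ (x ∷ xs) {i = zero} _ = refl
at-++ˡ (x ∷ xs) {i = suc i} (s≤s p) = at-++ˡ xs p

at-++ʳ : ∀ xs {ys} i → at (xs ++ ys) (length xs + i) ≡ at ys i
at-++ʳ [] i = refl
at-++ʳ (x ∷ xs) i = at-++ʳ xs i

at-map : ∀ f → f 0 ≡ 0 → ∀ xs i → at (map f xs) i ≡ f (at xs i)
at-map f f0 [] i = sym f0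
at-map f f0 (x ∷ xs) zero = refl
at-map f f0 (x ∷ xs) (suc i) = at-map f f0 xs i

at∈ : ∀ xs {i} → i < length xs → at xs i ∈ xs
at∈ (x ∷ xs) {zero} _ = here refl
at∈ (x ∷ xs) {suc i} (s≤s p) = there (at∈ xs p)

∈⇒at : ∀ {x} → x ∈ xs → ∃ λ i → i < length xs × x ≡ at xs i
∈⇒at (here refl) = 0 , z<s , refl
∈⇒at (there p) = let i , i< , eq = ∈⇒at p in suc i , s<s i< , eq

at-injective : Unique xs → ∀ {i j} → i < length xs → j < length xs → at xs i ≡ at xs j → i ≡ j
at-injective {x ∷ xs} (x∉ ∷ u) {zero} {zero} _ _ _ = refl
at-injective {x ∷ xs} (x∉ ∷ u) {zero} {suc j} _ (s≤s q) eq = contradiction eq (All.lookup x∉ (at∈ xs q))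
at-injective {x ∷ xs} (x∉ ∷ u) {suc i} {zero} (s≤s p) _ eq = contradiction (sym eq) (All.lookup x∉ (at∈ xs p))
at-injective {x ∷ xs} (x∉ ∷ u) {suc i} {suc j} (s≤s p) (s≤s q) eq = cong suc (at-injective u p q eq)

-- Lattice points of a cube

boxLayer : ℕ → ℕ → ℕ → List (List ℕ)
boxLayer k b x = map (x ∷_) (box k b)

∈-box⁻ : ∀ k b {xs} → xs ∈ box k b → length xs ≡ k × (∀ i → at xs i ≤ b)
∈-box⁻ zero b (here refl) = refl , λ _ → z≤n
∈-box⁻ (suc k) b p with ∈-concatMap-elim (boxLayer k b) {upTo (suc b)} p
... | x , x∈ , q with ∈-map⁻ (x ∷_) q
... | xs , xs∈ , refl = let l , h = ∈-box⁻ k b xs∈ in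
  cong suc l , λ { zero → s≤s⁻¹ (∈-upTo⁻ x∈) ; (suc i) → h i }

∈-box⁺ : ∀ k b {xs} → length xs ≡ k → (∀ {i} → i < length xs → at xs i ≤ b) → xs ∈ box k b
∈-box⁺ zero b {[]} _ _ = here refl
∈-box⁺ (suc k) b {x ∷ xs} l h = ∈-concatMap-intro (boxLayer k b) (∈-upTo⁺ (s≤s (h z<s)))
  (∈-map⁺ (x ∷_) (∈-box⁺ k b (suc-injective l) (h ∘ s<s)))

unique-box : ∀ k b → Unique (box k b)
unique-box zero b = [] ∷ []
unique-box (suc k) b = unique-concatMap (boxLayer k b) (Unique.upTo⁺ (suc b)) (λ _ → Unique.map⁺ ∷-injectiveʳ (unique-box k b))
  λ {x} {x′} _ _ p q → let _ , _ , eq = ∈-map⁻ (x ∷_) p ; _ , _ , eq′ = ∈-map⁻ (x′ ∷_) q in ∷-injectiveˡ (trans (sym eq) eq′)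

length-box : ∀ k b → length (box k b) ≡ suc b ^ k
length-box zero b = refl
length-box (suc k) b = trans (length-concatMap (boxLayer k b) (upTo (suc b)) (λ {x} _ → trans (length-map (x ∷_) (box k b)) (length-box k b)))
  (cong (_* suc b ^ k) (length-upTo (suc b)))

-- Permutations and subsets

∈-insertions⁻ : ∀ x w {v} → v ∈ insertions x w → ∃₂ λ as bs → w ≡ as ++ bs × v ≡ as ++ x ∷ bs
∈-insertions⁻ x [] (here refl) = [] , [] , refl , refl
∈-insertions⁻ x (y ∷ w) (here refl) = [] , y ∷ w , refl , refl
∈-insertions⁻ x (y ∷ w) (there p) with ∈-map⁻ (y ∷_) p
... | v , v∈ , refl with ∈-insertions⁻ x w v∈
... | as , bs , refl , refl = y ∷ as , bs , refl , refl

∈-insertions⁺ : ∀ x as bs → as ++ x ∷ bs ∈ insertions x (as ++ bs)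
∈-insertions⁺ x [] [] = here refl
∈-insertions⁺ x [] (b ∷ bs) = here refl
∈-insertions⁺ x (a ∷ as) bs = there (∈-map⁺ (a ∷_) (∈-insertions⁺ x as bs))

unique-insertions : ∀ {x} w → x ∉ w → Unique (insertions x w)
unique-insertions [] _ = [] ∷ []
unique-insertions {x} (y ∷ w) x∉ =
  All.tabulate (λ v∈ eq → let _ , _ , eq′ = ∈-map⁻ (y ∷_) v∈ in x∉ (here (∷-injectiveˡ (trans eq eq′))))
  ∷ Unique.map⁺ ∷-injectiveʳ (unique-insertions w (x∉ ∘ there))

length-insertions : ∀ x w → length (insertions x w) ≡ suc (length w)
length-insertions x [] = refl
length-insertions x (y ∷ w) = cong suc (trans (length-map (y ∷_) (insertions x w)) (length-insertions x w))

insertions-map : ∀ (f : ℕ → ℕ) x w → insertions (f x) (map f w) ≡ map (map f) (insertions x w)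
insertions-map f x [] = refl
insertions-map f x (y ∷ w) = cong ((f x ∷ f y ∷ map f w) ∷_)
  (trans (cong (map (f y ∷_)) (insertions-map f x w))
    (trans (sym (map-∘ {g = f y ∷_} {f = map f} (insertions x w))) (map-∘ {g = map f} {f = y ∷_} (insertions x w))))

-- Deleting x recovers w from any insertion of x into w.
insertion-injective : ∀ x {w w′ v} → x ∉ w → x ∉ w′ → v ∈ insertions x w → v ∈ insertions x w′ → w ≡ w′
insertion-injective x x∉ x∉′ p q = trans (sym (recover x∉ p)) (recover x∉′ q)
  where
  others : ∀ {as} → x ∉ as → filter (¬? ∘ (_≟ x)) as ≡ as
  others {as} x∉as = filter-all (¬? ∘ (_≟ x)) (All.tabulate λ y∈ eq → x∉as (subst (_∈ as) eq y∈))
  recover : ∀ {w v} → x ∉ w → v ∈ insertions x w → filter (¬? ∘ (_≟ x)) v ≡ w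
  recover {w} x∉w p with ∈-insertions⁻ x w p
  ... | as , bs , refl , refl = trans (filter-++ (¬? ∘ (_≟ x)) as (x ∷ bs))
    (cong₂ _++_ (others (x∉w ∘ ∈-++⁺ˡ))
      (trans (filter-reject (¬? ∘ (_≟ x)) (λ ne → ne refl)) (others (x∉w ∘ ∈-++⁺ʳ as))))

∈-perms⇒↭ : ∀ xs {v} → v ∈ perms xs → v ↭ xs
∈-perms⇒↭ [] (here refl) = ↭-refl
∈-perms⇒↭ (x ∷ xs) v∈ with ∈-concatMap-elim (insertions x) v∈
... | w , w∈ , p with ∈-insertions⁻ x w p
... | as , bs , refl , refl = ↭-trans (shift x as bs) (prep x (∈-perms⇒↭ xs w∈))

unique-++-∷⁻ : ∀ (as : List ℕ) {x bs} → Unique (as ++ x ∷ bs) → Unique (as ++ bs) × x ∉ as ++ bs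
unique-++-∷⁻ [] (x∉ ∷ u) = u , λ x∈ → All.lookup x∉ x∈ refl
unique-++-∷⁻ (a ∷ as) {x} {bs} (a∉ ∷ u) with unique-++-∷⁻ as u
... | u′ , x∉ = All.tabulate (λ y∈ → All.lookup a∉ (weaken y∈)) ∷ u′ ,
  λ { (here refl) → All.lookup a∉ (∈-++⁺ʳ as (here refl)) refl ; (there x∈) → x∉ x∈ }
  where
  weaken : ∀ {y} → y ∈ as ++ bs → y ∈ as ++ x ∷ bs
  weaken y∈ with ∈-++⁻ as y∈
  ... | inj₁ p = ∈-++⁺ˡ p
  ... | inj₂ p = ∈-++⁺ʳ as (there p)

-- Pigeonhole: if x were missing from w, the distinct entries of w would all lie in the shorter list
-- `xs`. So x can be removed from both lists, and the recursion continues.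
unique⊆⇒∈-perms : ∀ xs {w} → Unique w → length w ≡ length xs → (∀ {y} → y ∈ w → y ∈ xs) → w ∈ perms xs
unique⊆⇒∈-perms [] {[]} _ _ _ = here refl
unique⊆⇒∈-perms (x ∷ xs) {w} u l sub with any? (x ≟_) w
... | no x∉ = contradiction (unique⊆⇒length≤ u sub′) (<⇒≱ (≤-reflexive (sym l)))
  where
  sub′ : ∀ {y} → y ∈ w → y ∈ xs
  sub′ y∈ with sub y∈
  ... | here refl = contradiction y∈ x∉
  ... | there p = p
... | yes x∈ with ∈-∃++ x∈
... | as , bs , refl with unique-++-∷⁻ as u
... | u′ , x∉ = ∈-concatMap-intro (insertions x)
  (unique⊆⇒∈-perms xs u′ (suc-injective (trans (sym (↭-length (shift x as bs))) l)) sub′)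
  (∈-insertions⁺ x as bs)
  where
  sub′ : ∀ {y} → y ∈ as ++ bs → y ∈ xs
  sub′ y∈ with sub (∈-resp-↭ (↭-sym (shift x as bs)) (there y∈))
  ... | here refl = contradiction y∈ x∉
  ... | there p = p

unique-resp-↭ : ∀ {xs ys : List ℕ} → xs ↭ ys → Unique xs → Unique ys
unique-resp-↭ p = ↭ₛ.Unique-resp-↭ (setoid ℕ) (↭⇒↭ₛ p)

unique-perms : ∀ xs → Unique xs → Unique (perms xs)
unique-perms [] _ = [] ∷ []
unique-perms (x ∷ xs) (x∉ ∷ u) = unique-concatMap (insertions x) (unique-perms xs u)
  (λ {w} w∈ → unique-insertions w (fresh w∈))
  λ w∈ w′∈ → insertion-injective x (fresh w∈) (fresh w′∈)
  where
  fresh : ∀ {w} → w ∈ perms xs → x ∉ w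
  fresh w∈ x∈ = All.lookup x∉ (∈-resp-↭ (∈-perms⇒↭ xs w∈) x∈) refl

length-perms : ∀ xs → length (perms xs) ≡ length xs !
length-perms [] = refl
length-perms (x ∷ xs) = trans
  (length-concatMap (insertions x) (perms xs) λ {w} w∈ → trans (length-insertions x w) (cong suc (↭-length (∈-perms⇒↭ xs w∈))))
  (trans (cong (_* suc (length xs)) (length-perms xs)) (*-comm (length xs !) (suc (length xs))))

perms-map : ∀ (f : ℕ → ℕ) xs → perms (map f xs) ≡ map (map f) (perms xs)
perms-map f [] = refl
perms-map f (x ∷ xs) = begin
  concatMap (insertions (f x)) (perms (map f xs))        ≡⟨ cong (concatMap (insertions (f x))) (perms-map f xs) ⟩
  concatMap (insertions (f x)) (map (map f) (perms xs))  ≡⟨ concatMap-map (insertions (f x)) (map f) (perms xs) ⟩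
  concatMap (insertions (f x) ∘ map f) (perms xs)        ≡⟨ concatMap-cong (insertions-map f x) (perms xs) ⟩
  concatMap (map (map f) ∘ insertions x) (perms xs)      ≡⟨ map-concatMap (map f) (insertions x) (perms xs) ⟨
  map (map f) (perms (x ∷ xs))                           ∎
  where open ≡-Reasoning

-- Subsets of a given size and their orderings

choose : ℕ → List ℕ → List (List ℕ)
choose zero _ = [] ∷ []
choose (suc k) [] = []
choose (suc k) (x ∷ xs) = map (x ∷_) (choose k xs) ++ choose (suc k) xs

∈-choose⇒⊆ : ∀ k xs {S} → S ∈ choose k xs → ∀ {y} → y ∈ S → y ∈ xs
∈-choose⇒⊆ zero xs (here refl) ()
∈-choose⇒⊆ (suc k) (x ∷ xs) S∈ y∈ with ∈-++⁻ (map (x ∷_) (choose k xs)) S∈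
... | inj₂ p = there (∈-choose⇒⊆ (suc k) xs p y∈)
... | inj₁ p with ∈-map⁻ (x ∷_) p
∈-choose⇒⊆ (suc k) (x ∷ xs) S∈ (here refl) | inj₁ p | S , S∈′ , refl = here refl
∈-choose⇒⊆ (suc k) (x ∷ xs) S∈ (there y∈) | inj₁ p | S , S∈′ , refl = there (∈-choose⇒⊆ k xs S∈′ y∈)

∈-choose⇒length : ∀ k xs {S} → S ∈ choose k xs → length S ≡ k
∈-choose⇒length zero xs (here refl) = refl
∈-choose⇒length (suc k) (x ∷ xs) S∈ with ∈-++⁻ (map (x ∷_) (choose k xs)) S∈
... | inj₂ p = ∈-choose⇒length (suc k) xs p
... | inj₁ p with ∈-map⁻ (x ∷_) p
... | S , S∈′ , refl = cong suc (∈-choose⇒length k xs S∈′)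

∈-choose⇒sorted : ∀ k {xs S} → AllPairs _<_ xs → S ∈ choose k xs → AllPairs _<_ S
∈-choose⇒sorted zero _ (here refl) = []
∈-choose⇒sorted (suc k) {x ∷ xs} (x< ∷ s) S∈ with ∈-++⁻ (map (x ∷_) (choose k xs)) S∈
... | inj₂ p = ∈-choose⇒sorted (suc k) s p
... | inj₁ p with ∈-map⁻ (x ∷_) p
... | S , S∈′ , refl = All.tabulate (λ y∈ → All.lookup x< (∈-choose⇒⊆ k xs S∈′ y∈)) ∷ ∈-choose⇒sorted k s S∈′

unique-choose : ∀ k {xs} → Unique xs → Unique (choose k xs)
unique-choose zero _ = [] ∷ []
unique-choose (suc k) [] = []
unique-choose (suc k) {x ∷ xs} (x∉ ∷ u) = Unique.++⁺ (Unique.map⁺ ∷-injectiveʳ (unique-choose k u)) (unique-choose (suc k) u) disjoint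
  where
  disjoint : ∀ {S} → ¬ (S ∈ map (x ∷_) (choose k xs) × S ∈ choose (suc k) xs)
  disjoint (p , q) with ∈-map⁻ (x ∷_) p
  ... | S , _ , refl = All.lookup x∉ (∈-choose⇒⊆ (suc k) xs q (here refl)) refl

sorted-↭⇒≡ : ∀ {xs ys} → AllPairs _<_ xs → AllPairs _<_ ys → xs ↭ ys → xs ≡ ys
sorted-↭⇒≡ {[]} _ _ p = sym (↭-empty-inv (↭-sym p))
sorted-↭⇒≡ {x ∷ xs} {[]} _ _ p with ↭-length p
... | ()
sorted-↭⇒≡ {x ∷ xs} {y ∷ ys} (x< ∷ s) (y< ∷ s′) p with heads
  where
  least : ∀ {x z : ℕ} {xs} → All (x <_) xs → z ∈ x ∷ xs → x ≤ z
  least x< (here refl) = ≤-refl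
  least x< (there z∈) = <⇒≤ (All.lookup x< z∈)
  heads : x ≡ y
  heads = ≤-antisym (least x< (∈-resp-↭ (↭-sym p) (here refl))) (least y< (∈-resp-↭ p (here refl)))
... | refl = cong (x ∷_) (sorted-↭⇒≡ s s′ (drop-∷ p))

sorted⇒unique : ∀ {xs} → AllPairs _<_ xs → Unique xs
sorted⇒unique = AllPairs.map <⇒≢

range : ℕ → List ℕ
range k = map suc (upTo k)

range≡applyUpTo : ∀ k → range k ≡ applyUpTo suc k
range≡applyUpTo = map-upTo suc

sorted-range : ∀ k → AllPairs _<_ (range k)
sorted-range k = subst (AllPairs _<_) (sym (range≡applyUpTo k)) (AllPairs.applyUpTo⁺₁ suc k λ i<j _ → s<s i<j)

length-range : ∀ k → length (range k) ≡ k
length-range k = trans (length-map suc (upTo k)) (length-upTo k)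

∈-range⁻ : ∀ {k x} → x ∈ range k → 0 < x × x ≤ k
∈-range⁻ x∈ with ∈-map⁻ suc x∈
... | y , y∈ , refl = z<s , ∈-upTo⁻ y∈

∈-range⁺ : ∀ {k x} → 0 < x → x ≤ k → x ∈ range k
∈-range⁺ {x = suc x} _ x≤k = ∈-map⁺ suc (∈-upTo⁺ x≤k)

-- Sequences without repetition, grouped by their set of values. For a fixed set only the order of
-- the entries matters to the digit conditions, so every set contributes equally, and it remains to
-- count the sets.
arrangements : ℕ → List ℕ → List (List ℕ)
arrangements k xs = concatMap perms (choose k xs)

-- An arrangement determines its set of values: two sets that share one are permutations of each
-- other, and sorted lists with that property coincide.
unique-arrangements : ∀ k {xs} → AllPairs _<_ xs → Unique (arrangements k xs)
unique-arrangements k {xs} s = unique-concatMap perms (unique-choose k (sorted⇒unique s))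
  (λ {S} S∈ → unique-perms S (sorted⇒unique (∈-choose⇒sorted k s S∈)))
  λ {S} {S′} S∈ S′∈ p q → sorted-↭⇒≡ (∈-choose⇒sorted k s S∈) (∈-choose⇒sorted k s S′∈)
    (↭-trans (↭-sym (∈-perms⇒↭ S p)) (∈-perms⇒↭ S′ q))

-- The binomial coefficient, by the recursion of choose rather than as a quotient of factorials.
C : ℕ → ℕ → ℕ
C s zero = 1
C zero (suc k) = 0
C (suc s) (suc k) = C s k + C s (suc k)

length-choose : ∀ k xs → length (choose k xs) ≡ C (length xs) k
length-choose zero [] = refl
length-choose zero (x ∷ xs) = refl
length-choose (suc k) [] = refl
length-choose (suc k) (x ∷ xs) = trans (length-++ (map (x ∷_) (choose k xs)))
  (cong₂ _+_ (trans (length-map (x ∷_) (choose k xs)) (length-choose k xs)) (length-choose (suc k) xs))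

-- This is (k+1) C(s, k+1) = (s - k) C(s, k) with the subtracted term moved to the left, since
-- truncated subtraction would spoil the induction by Pascal's rule.
C-absorption : ∀ s k → suc k * C s (suc k) + k * C s k ≡ s * C s k
C-absorption zero zero = refl
C-absorption zero (suc k) = cong₂ _+_ (*-zeroʳ k) (*-zeroʳ k)
C-absorption (suc s) zero = trans (regroup (C s 1)) (cong suc (C-absorption s zero))
  where
  regroup : ∀ a → 1 * (1 + a) + 0 * 1 ≡ suc (1 * a + 0 * 1)
  regroup = solve-∀
C-absorption (suc s) (suc k) = begin
  suc (suc k) * (b + c) + suc k * (a + b)                            ≡⟨ regroup k a b c ⟩
  (suc (suc k) * c + suc k * b) + (suc k * b + k * a) + (a + b)      ≡⟨ cong₂ (λ u v → u + v + (a + b)) (C-absorption s (suc k)) (C-absorption s k) ⟩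
  s * b + s * a + (a + b)                                            ≡⟨ regroup′ s a b ⟩
  suc s * (a + b)                                                    ∎
  where
  open ≡-Reasoning
  a b c : ℕ
  a = C s k
  b = C s (suc k)
  c = C s (suc (suc k))
  regroup : ∀ k a b c → suc (suc k) * (b + c) + suc k * (a + b) ≡ (suc (suc k) * c + suc k * b) + (suc k * b + k * a) + (a + b)
  regroup = solve-∀
  regroup′ : ∀ s a b → s * b + s * a + (a + b) ≡ suc s * (a + b)
  regroup′ = solve-∀

-- The falling factorial s (s-1) ⋯ (s-k+1), which counts the sequences of k distinct digits from 1,
-- ..., s.
falling : ℕ → ℕ → ℕ
falling s k = k ! * C s k

falling-suc : ∀ s k → falling s (suc k) + k * falling s k ≡ s * falling s k
falling-suc s k = trans (regroup k (k !) (C s (suc k)) (C s k))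
  (trans (cong (k ! *_) (C-absorption s k)) (swap* (k !) s (C s k)))
  where
  regroup : ∀ k f b a → suc k * f * b + k * (f * a) ≡ f * (suc k * b + k * a)
  regroup = solve-∀
  swap* : ∀ f s a → f * (s * a) ≡ s * (f * a)
  swap* = solve-∀

falling≤power : ∀ s k → falling s k ≤ suc s ^ k
falling≤power s zero = ≤-refl
falling≤power s (suc k) = begin
  falling s (suc k)                    ≤⟨ m≤m+n _ _ ⟩
  falling s (suc k) + k * falling s k  ≡⟨ falling-suc s k ⟩
  s * falling s k                      ≤⟨ *-mono-≤ (n≤1+n s) (falling≤power s k) ⟩
  suc s ^ suc k                        ∎
  where open ≤-Reasoning

-- The triangular number 1 + 2 + ⋯ + k, the coefficient of the first-order error in `power≤falling`.
gap : ℕ → ℕ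
gap zero = 0
gap (suc k) = suc k + gap k

-- With t = s + 1 the falling factorial is (t-1)(t-2) ⋯ (t-k), and the product of the factors 1 -
-- j/t is at least 1 minus the sum of the j/t. Multiplying by t avoids the exponent k - 1, which is
-- not a natural number for k = 0.
power≤falling : ∀ s k → suc s * suc s ^ k ≤ suc s * falling s k + gap k * suc s ^ k
power≤falling s zero = m≤m+n _ _
power≤falling s (suc k) = begin
  t * t ^ suc k                                          ≤⟨ *-monoʳ-≤ t (power≤falling s k) ⟩
  t * (t * falling s k + gap k * t ^ k)                  ≡⟨ regroup s (falling s k) (gap k) (t ^ k) ⟩
  t * (s * falling s k + falling s k) + gap k * t ^ suc k
    ≡⟨ cong (λ u → t * (u + falling s k) + gap k * t ^ suc k) (falling-suc s k) ⟨
  t * (falling s (suc k) + k * falling s k + falling s k) + gap k * t ^ suc k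
    ≡⟨ regroup′ s k (falling s (suc k)) (falling s k) (gap k * t ^ suc k) ⟩
  t * falling s (suc k) + suc k * (t * falling s k) + gap k * t ^ suc k
    ≤⟨ +-monoˡ-≤ (gap k * t ^ suc k) (+-monoʳ-≤ (t * falling s (suc k)) (*-monoʳ-≤ (suc k) (*-monoʳ-≤ t (falling≤power s k)))) ⟩
  t * falling s (suc k) + suc k * t ^ suc k + gap k * t ^ suc k
    ≡⟨ regroup″ (t * falling s (suc k)) k (gap k) (t ^ suc k) ⟩
  t * falling s (suc k) + gap (suc k) * t ^ suc k        ∎
  where
  open ≤-Reasoning
  t : ℕ
  t = suc s
  regroup : ∀ s f g p → suc s * (suc s * f + g * p) ≡ suc s * (s * f + f) + g * (suc s * p)
  regroup = solve-∀
  regroup′ : ∀ s k f′ f r → suc s * (f′ + k * f + f) + r ≡ suc s * f′ + suc k * (suc s * f) + r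
  regroup′ = solve-∀
  regroup″ : ∀ u k g p → u + suc k * p + g * p ≡ u + (suc k + g) * p
  regroup″ = solve-∀

-- Limits of quotients

fraction-≤ : ∀ a b c e .{{_ : NonZero b}} .{{_ : NonZero e}} p q .{co : Coprime (suc p) (suc q)} → a * (e * suc q) ≤ (c * suc q + suc p * e) * b →
  (ℤ.+ a) ℚ./ b ℚ.≤ ((ℤ.+ c) ℚ./ e) ℚ.+ ℚ.mkℚ ℤ.+[1+ p ] q co
fraction-≤ a (suc b) c (suc e) p q {co} h = ℚ.toℚᵘ-cancel-≤ (begin
  ℚ.toℚᵘ ((ℤ.+ a) ℚ./ suc b)                       ≃⟨ ℚ.toℚᵘ-fromℚᵘ (ℚᵘ.mkℚᵘ (ℤ.+ a) b) ⟩
  ℚᵘ.mkℚᵘ (ℤ.+ a) b                                ≤⟨ ℚᵘ.*≤* cross ⟩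
  ℚᵘ.mkℚᵘ (ℤ.+ c) e ℚᵘ.+ ℚ.toℚᵘ ε                  ≃⟨ ℚᵘ.+-cong (ℚ.toℚᵘ-fromℚᵘ (ℚᵘ.mkℚᵘ (ℤ.+ c) e)) (ℚᵘ.≃-refl {ℚ.toℚᵘ ε}) ⟨
  ℚ.toℚᵘ ((ℤ.+ c) ℚ./ suc e) ℚᵘ.+ ℚ.toℚᵘ ε         ≃⟨ ℚ.toℚᵘ-homo-+ ((ℤ.+ c) ℚ./ suc e) ε ⟨
  ℚ.toℚᵘ (((ℤ.+ c) ℚ./ suc e) ℚ.+ ε)               ∎)
  where
  open ℚᵘ.≤-Reasoning
  ε : ℚ.ℚ
  ε = ℚ.mkℚ ℤ.+[1+ p ] q co
  cross : (ℤ.+ a) ℤ.* (ℤ.+ (suc e * suc q)) ℤ.≤ ((ℤ.+ c) ℤ.* (ℤ.+ suc q) ℤ.+ (ℤ.+ suc p) ℤ.* (ℤ.+ suc e)) ℤ.* (ℤ.+ suc b)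
  cross = subst₂ ℤ._≤_ (ℤ.pos-* a (suc e * suc q))
    (trans (ℤ.pos-* (c * suc q + suc p * suc e) (suc b))
      (cong (ℤ._* (ℤ.+ suc b)) (trans (ℤ.pos-+ (c * suc q) (suc p * suc e)) (cong₂ ℤ._+_ (ℤ.pos-* c (suc q)) (ℤ.pos-* (suc p) (suc e))))))
    (ℤ.+≤+ h)

∣-∣≤ : ∀ x y ε → x ℚ.≤ y ℚ.+ ε → y ℚ.≤ x ℚ.+ ε → ℚ.∣ x ℚ.- y ∣ ℚ.≤ ε
∣-∣≤ x y ε x≤ y≤ with ℚ.∣p∣≡p∨∣p∣≡-p (x ℚ.- y)
... | inj₁ eq = subst (ℚ._≤ ε) (sym eq) (move x y x≤)
  where
  move : ∀ x y → x ℚ.≤ y ℚ.+ ε → x ℚ.- y ℚ.≤ ε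
  move x y h = subst (x ℚ.- y ℚ.≤_) (AbelianGroup.xyx⁻¹≈y ℚ.+-0-abelianGroup y ε) (ℚ.+-monoˡ-≤ (ℚ.- y) h)
... | inj₂ eq = subst (ℚ._≤ ε) (sym (trans eq (Group.⁻¹-anti-homo-// ℚ.+-0-group x y)))
  (subst (y ℚ.- x ℚ.≤_) (AbelianGroup.xyx⁻¹≈y ℚ.+-0-abelianGroup x ε) (ℚ.+-monoˡ-≤ (ℚ.- x) y≤))

-- After division by t D the bounds say that X / D differs from K by at most B / t, which tends to
-- 0. In the multiplied form they are inequalities between natural numbers.
isNormalizedVolume : ∀ n c d K B →
  (∀ s → let t = suc s ; D = t ^ (n ∸ 1) ; X = (n ∸ 1) ! * dilateCount n c d t in
    t * X ≤ t * (K * D) + B * D × t * (K * D) ≤ t * X + B * D) →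
  IsNormalizedVolume n c d ((ℤ.+ K) ℚ./ 1)
isNormalizedVolume n c d K B bounds (ℚ.mkℚ (ℤ.+ zero) q _) (ℚ.*<* (ℤ.+<+ ()))
isNormalizedVolume n c d K B bounds (ℚ.mkℚ ℤ.-[1+ _ ] q _) (ℚ.*<* ())
-- Here ε = (p+1)/(q+1) is at least 1/(q+1), and B / t ≤ 1/(q+1) as soon as t ≥ B (q+1). The
-- numerator enters only through the extra term p D at the end.
isNormalizedVolume n c d K B bounds (ℚ.mkℚ ℤ.+[1+ p ] q co) _ = B * suc q , close
  where
  close : ∀ s → B * suc q ≤ s →
    ℚ.∣ ((ℤ.+ ((n ∸ 1) ! * dilateCount n c d (suc s))) ℚ./ (suc s ^ (n ∸ 1))) {{m^n≢0 (suc s) (n ∸ 1)}} ℚ.- (ℤ.+ K) ℚ./ 1 ∣ ℚ.≤ ℚ.mkℚ ℤ.+[1+ p ] q co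
  close s T≤s = ∣-∣≤ ((ℤ.+ X) ℚ./ D) ((ℤ.+ K) ℚ./ 1) (ℚ.mkℚ ℤ.+[1+ p ] q co)
    (fraction-≤ X D K 1 p q upper) (fraction-≤ K 1 X D p q lower)
    where
    t D X : ℕ
    t = suc s
    D = t ^ (n ∸ 1)
    X = (n ∸ 1) ! * dilateCount n c d t
    instance
      D≢0 : NonZero D
      D≢0 = m^n≢0 t (n ∸ 1)
    open ≤-Reasoning
    scale : ∀ u v → t * u ≤ t * v + B * D → u * suc q ≤ v * suc q + D
    scale u v h = *-cancelˡ-≤ t (begin
      t * (u * suc q)                  ≡⟨ *-assoc t u (suc q) ⟨
      t * u * suc q                    ≤⟨ *-monoˡ-≤ (suc q) h ⟩
      (t * v + B * D) * suc q          ≡⟨ regroup t v B D q ⟩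
      t * (v * suc q) + B * suc q * D  ≤⟨ +-monoʳ-≤ (t * (v * suc q)) (*-monoˡ-≤ D (≤-trans T≤s (n≤1+n s))) ⟩
      t * (v * suc q) + t * D          ≡⟨ *-distribˡ-+ t (v * suc q) D ⟨
      t * (v * suc q + D)              ∎)
      where
      regroup : ∀ t v B D q → (t * v + B * D) * suc q ≡ t * (v * suc q) + B * suc q * D
      regroup = solve-∀
    upper : X * (1 * suc q) ≤ (K * suc q + suc p * 1) * D
    upper = begin
      X * (1 * suc q)               ≡⟨ cong (X *_) (*-identityˡ (suc q)) ⟩
      X * suc q                     ≤⟨ scale X (K * D) (proj₁ (bounds s)) ⟩
      K * D * suc q + D             ≤⟨ m≤m+n _ (p * D) ⟩
      K * D * suc q + D + p * D     ≡⟨ regroup K D q p ⟩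
      (K * suc q + suc p * 1) * D   ∎
      where
      regroup : ∀ K D q p → K * D * suc q + D + p * D ≡ (K * suc q + suc p * 1) * D
      regroup = solve-∀
    lower : K * (D * suc q) ≤ (X * suc q + suc p * D) * 1
    lower = begin
      K * (D * suc q)               ≡⟨ *-assoc K D (suc q) ⟨
      K * D * suc q                 ≤⟨ scale (K * D) X (proj₂ (bounds s)) ⟩
      X * suc q + D                 ≤⟨ m≤m+n _ (p * D) ⟩
      X * suc q + D + p * D         ≡⟨ regroup X D q p ⟩
      (X * suc q + suc p * D) * 1   ∎
      where
      regroup : ∀ X D q p → X * suc q + D + p * D ≡ (X * suc q + suc p * D) * 1
      regroup = solve-∀

-- Partial sums of lattice points, written in base t

-- This indicator has two uses: the carry when two-digit numbers are compared, and the contribution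
-- of one descent to `linDes`. That both are the same function links the lattice points to the
-- descents.
lt : ℕ → ℕ → ℕ
lt a b = if a <ᵇ b then 1 else 0

lt-view : ∀ a b → (a < b × lt a b ≡ 1) ⊎ (b ≤ a × lt a b ≡ 0)
lt-view a b with a <ᵇ b in eq
... | true = inj₁ (<ᵇ⇒< a b (subst T (sym eq) tt) , refl)
... | false = inj₂ (≮⇒≥ (λ a<b → subst T eq (<⇒<ᵇ a<b)) , refl)

lt-monotone : ∀ {f : ℕ → ℕ} → (∀ {i j} → i < j → f i < f j) → ∀ a b → lt (f a) (f b) ≡ lt a b
lt-monotone {f} mono a b with lt-view a b | lt-view (f a) (f b)
... | inj₁ (_ , eq) | inj₁ (_ , eq′) = trans eq′ (sym eq)
... | inj₂ (_ , eq) | inj₂ (_ , eq′) = trans eq′ (sym eq)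
... | inj₁ (a<b , _) | inj₂ (fb≤ , _) = contradiction (mono a<b) (≤⇒≯ fb≤)
... | inj₂ (b≤a , _) | inj₁ (fa< , _) with m≤n⇒m<n∨m≡n b≤a
...   | inj₁ b<a = contradiction (mono b<a) (<-asym fa<)
...   | inj₂ refl = contradiction fa< (<-irrefl refl)

-- Two-digit numbers are compared lexicographically: if the low digit drops, the high digit must
-- grow by at least one; otherwise it only must not decrease.
digits-≤⁻ : ∀ {t r r′} q q′ → r′ < t → r + q * t ≤ r′ + q′ * t → q + lt r′ r ≤ q′
digits-≤⁻ {t} {r} {r′} q q′ r′<t h with lt-view r′ r
... | inj₁ (r′<r , eq) = subst (λ u → q + u ≤ q′) (sym eq) (subst (_≤ q′) (+-comm 1 q) (≰⇒> λ q′≤q →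
  <⇒≱ (+-mono-<-≤ r′<r (*-monoˡ-≤ t q′≤q)) h))
... | inj₂ (r≤r′ , eq) = subst (λ u → q + u ≤ q′) (sym eq) (subst (_≤ q′) (sym (+-identityʳ q)) (≮⇒≥ λ q′<q →
  <⇒≱ (<-≤-trans (+-monoˡ-< (q′ * t) r′<t) (≤-trans (*-monoˡ-≤ t q′<q) (m≤n+m (q * t) r))) h))

digits-≤⁺ : ∀ {t r r′} q q′ → r < t → q + lt r′ r ≤ q′ → r + q * t ≤ r′ + q′ * t
digits-≤⁺ {t} {r} {r′} q q′ r<t h with lt-view r′ r
... | inj₁ (r′<r , eq) = ≤-trans (+-monoˡ-≤ (q * t) (<⇒≤ r<t))
  (≤-trans (*-monoˡ-≤ t (subst (_≤ q′) (+-comm q 1) (subst (λ u → q + u ≤ q′) eq h))) (m≤n+m (q′ * t) r′))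
... | inj₂ (r≤r′ , eq) = +-mono-≤ r≤r′ (*-monoˡ-≤ t (subst (_≤ q′) (+-identityʳ q) (subst (λ u → q + u ≤ q′) eq h)))

digits-% : ∀ {t r} q .{{_ : NonZero t}} → r < t → (r + q * t) % t ≡ r
digits-% {t} {r} q r<t = trans ([m+kn]%n≡m%n r q t) (m<n⇒m%n≡m r<t)

digits-/ : ∀ {t r} q .{{_ : NonZero t}} → r < t → (r + q * t) / t ≡ q
digits-/ {t} {r} q r<t = begin
  (r + q * t) / t      ≡⟨ +-distrib-/-∣ʳ r (divides q refl) ⟩
  r / t + q * t / t    ≡⟨ cong₂ _+_ (m<n⇒m/n≡0 r<t) (m*n/n≡m q t) ⟩
  q                    ∎
  where open ≡-Reasoning

psum : List ℕ → ℕ → ℕ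
psum [] _ = 0
psum (x ∷ xs) zero = 0
psum (x ∷ xs) (suc i) = x + psum xs i

psum-zero : ∀ xs → psum xs 0 ≡ 0
psum-zero [] = refl
psum-zero (_ ∷ _) = refl

psum-suc : ∀ xs i → psum xs (suc i) ≡ psum xs i + at xs i
psum-suc [] i = refl
psum-suc (x ∷ xs) zero = trans (cong (_+_ x) (psum-zero xs)) (+-identityʳ x)
psum-suc (x ∷ xs) (suc i) = trans (cong (_+_ x) (psum-suc xs i)) (sym (+-assoc x (psum xs i) (at xs i)))

psum-length : ∀ xs → psum xs (length xs) ≡ sum xs
psum-length [] = refl
psum-length (x ∷ xs) = cong (_+_ x) (psum-length xs)

differences : (ℕ → ℕ) → ℕ → List ℕ
differences p n = applyUpTo (λ i → p (suc i) ∸ p i) n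

psum-differences : ∀ p n → p 0 ≡ 0 → (∀ {i} → i < n → p i ≤ p (suc i)) → ∀ {i} → i ≤ n → psum (differences p n) i ≡ p i
psum-differences p n p0 mono {zero} _ = trans (psum-zero (differences p n)) (sym p0)
psum-differences p n p0 mono {suc i} i<n = begin
  psum (differences p n) (suc i)                       ≡⟨ psum-suc (differences p n) i ⟩
  psum (differences p n) i + at (differences p n) i    ≡⟨ cong₂ _+_ (psum-differences p n p0 mono (<⇒≤ i<n)) (at-applyUpTo (λ i → p (suc i) ∸ p i) i<n) ⟩
  p i + (p (suc i) ∸ p i)                              ≡⟨ m+[n∸m]≡n (mono i<n) ⟩
  p (suc i)                                            ∎
  where open ≡-Reasoning

module Walk (c d m : ℕ) where

  -- Both sequences are completed at positions 0 and m + 1 by the digits of p_0 = 0 and p_n = c t.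
  -- The last remainder 0 is the default value of `at` beyond the end of `r`.
  quot rem : List ℕ → ℕ → ℕ
  quot q i = at (0 ∷ q ++ [ c ]) i
  rem r i = at (0 ∷ r) i

  quot-inner : ∀ {q} → length q ≡ m → ∀ {i} → i < m → quot q (suc i) ≡ at q i
  quot-inner {q} refl = at-++ˡ q

  quot-last : ∀ {q} → length q ≡ m → quot q (suc m) ≡ c
  quot-last {q} refl = trans (cong (at (q ++ [ c ])) (sym (+-identityʳ (length q)))) (at-++ʳ q 0)

  rem-last : ∀ {r} → length r ≡ m → rem r (suc m) ≡ 0
  rem-last {r} refl = at-beyond r ≤-refl

  -- The condition p_i ≤ p_{i+1} ≤ p_i + d t for p_i = r_i + q_i t with digits r_i < t (and p_0 = 0, p_n = c t, n = m + 1),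
  -- written so that the digits r_i enter only through their relative order.
  Step : (q r : List ℕ) → ℕ → Set
  Step q r i = quot q i + lt (rem r (suc i)) (rem r i) ≤ quot q (suc i)
    × quot q (suc i) + lt (rem r i) (rem r (suc i)) ≤ quot q i + d

  Valid : List ℕ × List ℕ → Set
  Valid (r , q) = ∀ {i} → i < suc m → Step q r i

  Valid? : Decidable Valid
  Valid? (r , q) = allUpTo? (λ i → (_ ≤? _) ×-dec (_ ≤? _)) (suc m)

  -- A walk increases to c t, so none of its quotients exceeds c. This makes the search space finite
  -- and independent of t.
  quotients : List (List ℕ)
  quotients = box m c

  validCount : List (List ℕ) → ℕ
  validCount rs = length (filter Valid? (cartesianProduct rs quotients))

  -- The partial sums of a lattice point of the t-th dilate. They form a function on all of ℕ,
  -- constrained only up to m + 1, so that an infinite periodic lift can itself be a walk, with t =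
  -- n.
  record IsWalk (t : ℕ) (p : ℕ → ℕ) : Set where
    field
      start : p 0 ≡ 0
      end : p (suc m) ≡ c * t
      up : ∀ {i} → i < suc m → p i ≤ p (suc i)
      bounded : ∀ {i} → i < suc m → p (suc i) ≤ p i + d * t

    ≤end : ∀ k {i} → i + k ≡ suc m → p i ≤ c * t
    ≤end zero {i} eq = ≤-reflexive (trans (cong p (trans (sym (+-identityʳ i)) eq)) end)
    ≤end (suc k) {i} eq = ≤-trans (up (≤-trans (m≤m+n (suc i) k) (≤-reflexive (trans (sym (+-suc i k)) eq))))
      (≤end k (trans (sym (+-suc i k)) eq))

  module _ (t : ℕ) .{{_ : NonZero t}} where

    encode : (ℕ → ℕ) → List ℕ × List ℕ
    encode p = applyUpTo (λ i → p (suc i) % t) m , applyUpTo (λ i → p (suc i) / t) m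

    position : List ℕ × List ℕ → ℕ → ℕ
    position (r , q) i = rem r i + quot q i * t

    module _ {p : ℕ → ℕ} (w : IsWalk t p) where
      open IsWalk w

      encode-rem : ∀ {i} → i ≤ suc m → rem (proj₁ (encode p)) i ≡ p i % t
      encode-rem {zero} _ = sym (trans (cong (_% t) start) (m*n%n≡0 0 t))
      encode-rem {suc i} (s≤s i≤m) with m≤n⇒m<n∨m≡n i≤m
      ... | inj₁ i<m = at-applyUpTo (λ i → p (suc i) % t) i<m
      ... | inj₂ refl = trans (rem-last {proj₁ (encode p)} (length-applyUpTo (λ i → p (suc i) % t) m))
        (sym (trans (cong (_% t) end) (m*n%n≡0 c t)))

      encode-quot : ∀ {i} → i ≤ suc m → quot (proj₂ (encode p)) i ≡ p i / t
      encode-quot {zero} _ = sym (trans (cong (_/ t) start) (0/n≡0 t))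
      encode-quot {suc i} (s≤s i≤m) with m≤n⇒m<n∨m≡n i≤m
      ... | inj₁ i<m = trans (quot-inner {proj₂ (encode p)} (length-applyUpTo (λ i → p (suc i) / t) m) i<m)
        (at-applyUpTo (λ i → p (suc i) / t) i<m)
      ... | inj₂ refl = trans (quot-last {proj₂ (encode p)} (length-applyUpTo (λ i → p (suc i) / t) m))
        (sym (trans (cong (_/ t) end) (m*n/n≡m c t)))

      encode-position : ∀ {i} → i ≤ suc m → position (encode p) i ≡ p i
      encode-position {i} i≤ = trans (cong₂ (λ u v → u + v * t) (encode-rem i≤) (encode-quot i≤)) (sym (m≡m%n+[m/n]*n (p i) t))

      encode-valid : Valid (encode p)
      encode-valid {i} i<n rewrite encode-rem (<⇒≤ i<n) | encode-rem i<n | encode-quot (<⇒≤ i<n) | encode-quot i<n =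
        digits-≤⁻ (p i / t) (p (suc i) / t) (m%n<n (p (suc i)) t)
          (subst₂ _≤_ (m≡m%n+[m/n]*n (p i) t) (m≡m%n+[m/n]*n (p (suc i)) t) (up i<n)) ,
        digits-≤⁻ (p (suc i) / t) (p i / t + d) (m%n<n (p i) t)
          (subst₂ _≤_ (m≡m%n+[m/n]*n (p (suc i)) t) shifted (bounded i<n))
        where
        regroup : ∀ a b d t → a + b * t + d * t ≡ a + (b + d) * t
        regroup = solve-∀
        shifted : p i + d * t ≡ p i % t + (p i / t + d) * t
        shifted = trans (cong (_+ d * t) (m≡m%n+[m/n]*n (p i) t)) (regroup (p i % t) (p i / t) d t)

      encode-quotients : proj₂ (encode p) ∈ quotients
      encode-quotients = ∈-box⁺ m c length-q λ {i} i<l → let i<m = subst (i <_) length-q i<l in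
        subst (_≤ c) (sym (at-applyUpTo (λ i → p (suc i) / t) i<m))
          (subst (p (suc i) / t ≤_) (m*n/n≡m c t) (/-monoˡ-≤ t (≤end (m ∸ i) (cong suc (m+[n∸m]≡n (<⇒≤ i<m))))))
        where
        length-q : length (proj₂ (encode p)) ≡ m
        length-q = length-applyUpTo (λ i → p (suc i) / t) m

    encode-injective : ∀ {p p′} → IsWalk t p → IsWalk t p′ → encode p ≡ encode p′ → ∀ {i} → i ≤ suc m → p i ≡ p′ i
    encode-injective w w′ eq {i} i≤ = trans (sym (encode-position w i≤)) (trans (cong (λ x → position x i) eq) (encode-position w′ i≤))

    module _ {r q : List ℕ} (|r| : length r ≡ m) (|q| : length q ≡ m) (r< : ∀ i → at r i < t) where

      rem< : ∀ i → rem r i < t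
      rem< zero = >-nonZero⁻¹ t
      rem< (suc i) = r< i

      position-walk : Valid (r , q) → IsWalk t (position (r , q))
      position-walk v = record
        { start = refl
        ; end = cong₂ (λ u v → u + v * t) (rem-last {r} |r|) (quot-last {q} |q|)
        ; up = λ {i} i<n → digits-≤⁺ (quot q i) (quot q (suc i)) (rem< i) (proj₁ (v i<n))
        ; bounded = λ {i} i<n → subst (position (r , q) (suc i) ≤_) (regroup (rem r i) (quot q i) d t)
            (digits-≤⁺ (quot q (suc i)) (quot q i + d) (rem< (suc i)) (proj₂ (v i<n)))
        }
        where
        regroup : ∀ a b d t → a + (b + d) * t ≡ a + b * t + d * t
        regroup = solve-∀

    position-injective : ∀ {r q r′ q′} → length r ≡ m → length q ≡ m → (∀ i → at r i < t) →
      length r′ ≡ m → length q′ ≡ m → (∀ i → at r′ i < t) →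
      (∀ {i} → i ≤ m → position (r , q) i ≡ position (r′ , q′) i) → (r , q) ≡ (r′ , q′)
    position-injective {r} {q} {r′} {q′} |r| |q| r< |r′| |q′| r′< eq = cong₂ _,_
      (at-ext (trans |r| (sym |r′|)) λ {i} i< → same-rem (subst (i <_) |r| i<))
      (at-ext (trans |q| (sym |q′|)) λ {i} i< → let i<m = subst (i <_) |q| i< in
        trans (sym (quot-inner {q} |q| i<m)) (trans (same-quot i<m) (quot-inner {q′} |q′| i<m)))
      where
      same-rem : ∀ {i} → i < m → at r i ≡ at r′ i
      same-rem {i} i<m = trans (sym (digits-% (quot q (suc i)) (r< i)))
        (trans (cong (_% t) (eq i<m)) (digits-% (quot q′ (suc i)) (r′< i)))
      same-quot : ∀ {i} → i < m → quot q (suc i) ≡ quot q′ (suc i)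
      same-quot {i} i<m = trans (sym (digits-/ (quot q (suc i)) (r< i)))
        (trans (cong (_/ t) (eq i<m)) (digits-/ (quot q′ (suc i)) (r′< i)))

-- The normalized volume as a number of alcoves

-- The increasing enumeration of `b ∷ S`, continued by steps of one past the end of the list. The
-- continuation keeps it strictly increasing on all of ℕ, as `lt-monotone` requires.
relabel : List ℕ → ℕ → ℕ → ℕ
relabel [] b i = i + b
relabel (s ∷ S) b zero = b
relabel (s ∷ S) b (suc i) = relabel S s i

relabel-zero : ∀ S b → relabel S b 0 ≡ b
relabel-zero [] b = refl
relabel-zero (s ∷ S) b = refl

relabel-lower : ∀ {S b} → AllPairs _<_ (b ∷ S) → ∀ i → b ≤ relabel S b i
relabel-lower {[]} _ i = m≤n+m _ i
relabel-lower {s ∷ S} _ zero = ≤-refl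
relabel-lower {s ∷ S} ((b<s ∷ _) ∷ p) (suc i) = ≤-trans (<⇒≤ b<s) (relabel-lower p i)

relabel-monotone : ∀ {S b} → AllPairs _<_ (b ∷ S) → ∀ {i j} → i < j → relabel S b i < relabel S b j
relabel-monotone {[]} _ i<j = +-monoˡ-< _ i<j
relabel-monotone {s ∷ S} ((b<s ∷ _) ∷ p) {zero} {suc j} _ = <-≤-trans b<s (relabel-lower p j)
relabel-monotone {s ∷ S} (_ ∷ p) {suc i} {suc j} (s≤s i<j) = relabel-monotone p i<j

applyUpTo-relabel : ∀ S b → applyUpTo (relabel S b ∘ suc) (length S) ≡ S
applyUpTo-relabel [] b = refl
applyUpTo-relabel (s ∷ S) b = cong₂ _∷_ (relabel-zero S s) (applyUpTo-relabel S s)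

map-relabel : ∀ S → map (relabel S 0) (range (length S)) ≡ S
map-relabel S = trans (cong (map (relabel S 0)) (range≡applyUpTo (length S)))
  (trans (map-applyUpTo suc (relabel S 0) (length S)) (applyUpTo-relabel S 0))

cartesianProduct-++ : (xs xs′ : List A) (ys : List B) →
  cartesianProduct (xs ++ xs′) ys ≡ cartesianProduct xs ys ++ cartesianProduct xs′ ys
cartesianProduct-++ [] xs′ ys = refl
cartesianProduct-++ (x ∷ xs) xs′ ys = trans (cong (map (x ,_) ys ++_) (cartesianProduct-++ xs xs′ ys))
  (sym (++-assoc (map (x ,_) ys) (cartesianProduct xs ys) (cartesianProduct xs′ ys)))

cartesianProduct-map : (f : A → A) (xs : List A) (ys : List B) →
  cartesianProduct (map f xs) ys ≡ map (λ (x , y) → f x , y) (cartesianProduct xs ys)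
cartesianProduct-map f [] ys = refl
cartesianProduct-map f (x ∷ xs) ys = trans (cong₂ _++_ (map-∘ ys) (cartesianProduct-map f xs ys))
  (sym (map-++ (λ (x , y) → f x , y) (map (x ,_) ys) (cartesianProduct xs ys)))

module Volume (c d m : ℕ) where
  open Walk c d m

  latticePoints : ℕ → List (List ℕ)
  latticePoints t = filterᵇ (λ v → sum v ≡ᵇ t * c) (box (suc m) (t * d))

  unique-latticePoints : ∀ t → Unique (latticePoints t)
  unique-latticePoints t = Unique.filter⁺ (T? ∘ λ v → sum v ≡ᵇ t * c) (unique-box (suc m) (t * d))

  ∈-latticePoints⁻ : ∀ t {x} → x ∈ latticePoints t → length x ≡ suc m × (∀ i → at x i ≤ t * d) × sum x ≡ t * c
  ∈-latticePoints⁻ t {x} x∈ with ∈-filter⁻ (T? ∘ λ v → sum v ≡ᵇ t * c) {xs = box (suc m) (t * d)} x∈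
  ... | x∈box , eq = let l , b = ∈-box⁻ (suc m) (t * d) x∈box in l , b , ≡ᵇ⇒≡ (sum x) (t * c) eq

  psum-walk : ∀ t {x} → x ∈ latticePoints t → IsWalk t (psum x)
  psum-walk t {x} x∈ = let l , b , eq = ∈-latticePoints⁻ t x∈ in record
    { start = psum-zero x
    ; end = trans (cong (psum x) (sym l)) (trans (psum-length x) (trans eq (*-comm t c)))
    ; up = λ {i} _ → subst (psum x i ≤_) (sym (psum-suc x i)) (m≤m+n (psum x i) (at x i))
    ; bounded = λ {i} _ → subst (_≤ psum x i + d * t) (sym (psum-suc x i))
        (+-monoʳ-≤ (psum x i) (subst (at x i ≤_) (*-comm t d) (b i)))
    }

  psum-injective : ∀ {x y} → length x ≡ suc m → length y ≡ suc m → (∀ {i} → i ≤ suc m → psum x i ≡ psum y i) → x ≡ y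
  psum-injective {x} {y} |x| |y| eq = at-ext (trans |x| (sym |y|)) λ {i} i< → let i<n = subst (i <_) |x| i< in
    +-cancelˡ-≡ (psum x i) (at x i) (at y i)
      (trans (sym (psum-suc x i)) (trans (eq i<n) (trans (psum-suc y i) (cong (_+ at y i) (sym (eq (<⇒≤ i<n)))))))

  Digits : ℕ → List ℕ → Set
  Digits t r = length r ≡ m × (∀ i → at r i < t)

  pairs : List (List ℕ) → List (List ℕ × List ℕ)
  pairs rs = filter Valid? (cartesianProduct rs quotients)

  ∈-pairs⁺ : ∀ {rs r q} → r ∈ rs → q ∈ quotients → Valid (r , q) → (r , q) ∈ pairs rs
  ∈-pairs⁺ r∈ q∈ v = ∈-filter⁺ Valid? (∈-cartesianProduct⁺ r∈ q∈) v

  ∈-pairs⁻ : ∀ rs {rq} → rq ∈ pairs rs → proj₁ rq ∈ rs × proj₂ rq ∈ quotients × Valid rq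
  ∈-pairs⁻ rs {rq} p = let p′ , v = ∈-filter⁻ Valid? {xs = cartesianProduct rs quotients} p
                           r∈ , q∈ = ∈-cartesianProduct⁻ rs quotients p′ in r∈ , q∈ , v

  unique-pairs : ∀ {rs} → Unique rs → Unique (pairs rs)
  unique-pairs u = Unique.filter⁺ Valid? (Unique.cartesianProduct⁺ u (unique-box m c))

  |latticePoints|≤ : ∀ s → length (latticePoints (suc s)) ≤ validCount (box m s)
  |latticePoints|≤ s = injection⇒length≤ (encode (suc s) ∘ psum) (unique-latticePoints (suc s))
    (λ {x} x∈ → ∈-pairs⁺ (∈-box⁺ m s (length-applyUpTo (λ i → psum x (suc i) % suc s) m) (small x))
      (encode-quotients (suc s) (psum-walk (suc s) x∈)) (encode-valid (suc s) (psum-walk (suc s) x∈)))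
    λ x∈ y∈ eq → psum-injective (proj₁ (∈-latticePoints⁻ (suc s) x∈)) (proj₁ (∈-latticePoints⁻ (suc s) y∈))
      (encode-injective (suc s) (psum-walk (suc s) x∈) (psum-walk (suc s) y∈) eq)
    where
    small : ∀ x {i} → i < length (proj₁ (encode (suc s) (psum x))) → at (proj₁ (encode (suc s) (psum x))) i ≤ s
    small x {i} i< = subst (_≤ s)
      (sym (at-applyUpTo (λ i → psum x (suc i) % suc s) (subst (i <_) (length-applyUpTo (λ i → psum x (suc i) % suc s) m) i<)))
      (s≤s⁻¹ (m%n<n (psum x (suc i)) (suc s)))

  ≤|latticePoints| : ∀ t .{{_ : NonZero t}} {rs} → Unique rs → (∀ {r} → r ∈ rs → Digits t r) → validCount rs ≤ length (latticePoints t)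
  ≤|latticePoints| t {rs} u digits = injection⇒length≤ (λ rq → differences (position t rq) (suc m)) (unique-pairs u)
    lattice injective
    where
    walk : ∀ {rq} → rq ∈ pairs rs → IsWalk t (position t rq)
    walk p = let r∈ , q∈ , v = ∈-pairs⁻ rs p
                 |r| , r< = digits r∈ in position-walk t |r| (proj₁ (∈-box⁻ m c q∈)) r< v

    psum≡position : ∀ {rq} → rq ∈ pairs rs → ∀ {i} → i ≤ suc m → psum (differences (position t rq) (suc m)) i ≡ position t rq i
    psum≡position {rq} p = psum-differences (position t rq) (suc m) (IsWalk.start (walk p)) (IsWalk.up (walk p))

    lattice : ∀ {rq} → rq ∈ pairs rs → differences (position t rq) (suc m) ∈ latticePoints t
    lattice {rq} p = ∈-filter⁺ (T? ∘ λ v → sum v ≡ᵇ t * c)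
      (∈-box⁺ (suc m) (t * d) |x| λ {i} i< → let i<n = subst (i <_) |x| i< in
        subst (_≤ t * d) (sym (at-applyUpTo (λ i → position t rq (suc i) ∸ position t rq i) i<n))
          (subst (position t rq (suc i) ∸ position t rq i ≤_) (*-comm d t)
            (m≤n+o⇒m∸n≤o _ (position t rq i) (IsWalk.bounded (walk p) i<n))))
      (≡⇒≡ᵇ (sum x) (t * c) (trans (sym (psum-length x)) (trans (cong (psum x) |x|)
        (trans (psum≡position p ≤-refl) (trans (IsWalk.end (walk p)) (*-comm c t))))))
      where
      x : List ℕ
      x = differences (position t rq) (suc m)
      |x| : length x ≡ suc m
      |x| = length-applyUpTo (λ i → position t rq (suc i) ∸ position t rq i) (suc m)

    injective : ∀ {rq rq′} → rq ∈ pairs rs → rq′ ∈ pairs rs →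
      differences (position t rq) (suc m) ≡ differences (position t rq′) (suc m) → rq ≡ rq′
    injective p p′ eq = let r∈ , q∈ , _ = ∈-pairs⁻ rs p
                            r′∈ , q′∈ , _ = ∈-pairs⁻ rs p′
                            |r| , r< = digits r∈
                            |r′| , r′< = digits r′∈ in
      position-injective t |r| (proj₁ (∈-box⁻ m c q∈)) r< |r′| (proj₁ (∈-box⁻ m c q′∈)) r′< λ {i} i≤m →
        trans (sym (psum≡position p (m≤n⇒m≤1+n i≤m))) (trans (cong (λ x → psum x i) eq) (psum≡position p′ (m≤n⇒m≤1+n i≤m)))

  -- `Step` sees the digits only through `lt`, which a strictly increasing map preserves. The value
  -- at 0 must stay 0 because the digits at both ends of the walk are 0 and are compared with the
  -- others.
  valid-map : ∀ {f : ℕ → ℕ} → f 0 ≡ 0 → (∀ {i j} → i < j → f i < f j) → ∀ r q → Valid (map f r , q) ⇔ Valid (r , q)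
  valid-map {f} f0 mono r q = mk⇔ (λ v {i} i<n → subst id (step i) (v i<n)) (λ v {i} i<n → subst id (sym (step i)) (v i<n))
    where
    rem-map : ∀ i → rem (map f r) i ≡ f (rem r i)
    rem-map zero = sym f0
    rem-map (suc i) = at-map f f0 r i
    step : ∀ i → Step q (map f r) i ≡ Step q r i
    step i rewrite rem-map i | rem-map (suc i) | lt-monotone mono (rem r i) (rem r (suc i)) | lt-monotone mono (rem r (suc i)) (rem r i) = refl

  -- The alcoved triangulation cuts the polytope into simplices of normalized volume 1. Up to scaling by n, the centre of
  -- such a simplex has partial sums whose base-n digits (r , q) form a valid pair with r a permutation of 1 … m.
  alcoves : ℕ
  alcoves = validCount (perms (range m))

  validCount-perms : ∀ {S} → length S ≡ m → AllPairs _<_ (0 ∷ S) → validCount (perms S) ≡ alcoves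
  validCount-perms {S} refl sorted = begin
    length (filter Valid? (cartesianProduct (perms S) quotients))
      ≡⟨ cong (λ S → length (filter Valid? (cartesianProduct (perms S) quotients))) (map-relabel S) ⟨
    length (filter Valid? (cartesianProduct (perms (map f (range m))) quotients))
      ≡⟨ cong (λ rs → length (filter Valid? (cartesianProduct rs quotients))) (perms-map f (range m)) ⟩
    length (filter Valid? (cartesianProduct (map (map f) (perms (range m))) quotients))
      ≡⟨ cong (length ∘ filter Valid?) (cartesianProduct-map (map f) (perms (range m)) quotients) ⟩
    length (filter Valid? (map (λ (r , q) → map f r , q) (cartesianProduct (perms (range m)) quotients)))
      ≡⟨ filter-map Valid? Valid? (λ (r , q) → map f r , q) (cartesianProduct (perms (range m)) quotients)
          (λ (r , q) → valid-map (relabel-zero S 0) (relabel-monotone sorted) r q) ⟩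
    alcoves ∎
    where
    open ≡-Reasoning
    f : ℕ → ℕ
    f = relabel S 0

  validCount-++ : ∀ rs rs′ → validCount (rs ++ rs′) ≡ validCount rs + validCount rs′
  validCount-++ rs rs′ = trans (cong (length ∘ filter Valid?) (cartesianProduct-++ rs rs′ quotients))
    (trans (cong length (filter-++ Valid? (cartesianProduct rs quotients) (cartesianProduct rs′ quotients)))
      (length-++ (pairs rs)))

  validCount-concatMap : ∀ Ss {k} → (∀ {S} → S ∈ Ss → validCount (perms S) ≡ k) → validCount (concatMap perms Ss) ≡ length Ss * k
  validCount-concatMap [] _ = refl
  validCount-concatMap (S ∷ Ss) h = trans (validCount-++ (perms S) (concatMap perms Ss))
    (cong₂ _+_ (h (here refl)) (validCount-concatMap Ss (h ∘ there)))

  -- The digits are taken from 1, ..., t - 1, where t = s + 1, because the endpoints already occupy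
  -- 0. A string with a vanishing digit therefore counts as degenerate, just like one with a
  -- repetition.
  injectiveDigits : ℕ → List (List ℕ)
  injectiveDigits s = arrangements m (range s)

  validCount-injectiveDigits : ∀ s → validCount (injectiveDigits s) ≡ C s m * alcoves
  validCount-injectiveDigits s = trans
    (validCount-concatMap (choose m (range s)) λ {S} S∈ → validCount-perms (∈-choose⇒length m (range s) S∈)
      (All.tabulate (λ y∈ → proj₁ (∈-range⁻ {s} (∈-choose⇒⊆ m (range s) S∈ y∈))) ∷ ∈-choose⇒sorted m (sorted-range s) S∈))
    (cong (_* alcoves) (trans (length-choose m (range s)) (cong (λ l → C l m) (length-range s))))

  length-injectiveDigits : ∀ s → length (injectiveDigits s) ≡ falling s m
  length-injectiveDigits s = trans
    (length-concatMap perms (choose m (range s)) λ {S} S∈ → trans (length-perms S) (cong _! (∈-choose⇒length m (range s) S∈)))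
    (trans (cong (_* m !) (trans (length-choose m (range s)) (cong (λ l → C l m) (length-range s)))) (*-comm (C s m) (m !)))

  injectiveDigits-digits : ∀ s {r} → r ∈ injectiveDigits s → Digits (suc s) r
  injectiveDigits-digits s {r} r∈ with ∈-concatMap-elim perms {choose m (range s)} r∈
  ... | S , S∈ , r∈S = trans (↭-length (∈-perms⇒↭ S r∈S)) (∈-choose⇒length m (range s) S∈) , bound
    where
    bound : ∀ i → at r i < suc s
    bound i with i <? length r
    ... | yes i< = s≤s (proj₂ (∈-range⁻ (∈-choose⇒⊆ m (range s) S∈ (∈-resp-↭ (∈-perms⇒↭ S r∈S) (at∈ r i<)))))
    ... | no i≮ = subst (_< suc s) (sym (at-beyond r (≮⇒≥ i≮))) z<s

  injectiveDigits⊆box : ∀ s {r} → r ∈ injectiveDigits s → r ∈ box m s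
  injectiveDigits⊆box s r∈ = let |r| , r< = injectiveDigits-digits s r∈ in ∈-box⁺ m s |r| λ {i} _ → s≤s⁻¹ (r< i)

  injective? : ∀ s → Decidable (_∈ injectiveDigits s)
  injective? s r = any? (≡-dec _≟_ r) (injectiveDigits s)

  degenerate : ℕ → List (List ℕ)
  degenerate s = filter (¬? ∘ injective? s) (box m s)

  |degenerate|≤ : ∀ s → falling s m + length (degenerate s) ≤ suc s ^ m
  |degenerate|≤ s = begin
    falling s m + length (degenerate s)                                   ≡⟨ cong (_+ length (degenerate s)) (length-injectiveDigits s) ⟨
    length (injectiveDigits s) + length (degenerate s)                    ≤⟨ +-monoˡ-≤ (length (degenerate s))
      (unique⊆⇒length≤ (unique-arrangements m (sorted-range s)) λ r∈ → ∈-filter⁺ (injective? s) (injectiveDigits⊆box s r∈) r∈) ⟩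
    length (filter (injective? s) (box m s)) + length (degenerate s)      ≡⟨ length-filter-¬? (injective? s) (box m s) ⟩
    length (box m s)                                                      ≡⟨ length-box m s ⟩
    suc s ^ m                                                             ∎
    where open ≤-Reasoning

  -- Each degenerate string is charged with all quotient sequences, valid or not. The degenerate
  -- strings are fewer than all strings by a factor of order t, so this crude bound disappears in
  -- the limit.
  validCount-box≤ : ∀ s → validCount (box m s) ≤ C s m * alcoves + length (degenerate s) * length quotients
  validCount-box≤ s = begin
    validCount (box m s)                                                             ≤⟨ unique⊆⇒length≤ (unique-pairs (unique-box m s)) cover ⟩
    length (pairs (injectiveDigits s) ++ cartesianProduct (degenerate s) quotients)  ≡⟨ length-++ (pairs (injectiveDigits s)) ⟩
    validCount (injectiveDigits s) + length (cartesianProduct (degenerate s) quotients)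
      ≡⟨ cong₂ _+_ (validCount-injectiveDigits s) (length-cartesianProduct (degenerate s) quotients) ⟩
    C s m * alcoves + length (degenerate s) * length quotients                       ∎
    where
    open ≤-Reasoning
    cover : ∀ {rq} → rq ∈ pairs (box m s) → rq ∈ pairs (injectiveDigits s) ++ cartesianProduct (degenerate s) quotients
    cover {r , q} p with ∈-pairs⁻ (box m s) p | injective? s r
    ... | r∈ , q∈ , v | yes inj = ∈-++⁺ˡ (∈-pairs⁺ {injectiveDigits s} {r} {q} inj q∈ v)
    ... | r∈ , q∈ , v | no ¬inj = ∈-++⁺ʳ (pairs (injectiveDigits s))
      (∈-cartesianProduct⁺ (∈-filter⁺ (¬? ∘ injective? s) r∈ ¬inj) q∈)

  normalizedVolume : IsNormalizedVolume (suc m) c d ((ℤ.+ alcoves) ℚ./ 1)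
  normalizedVolume = isNormalizedVolume (suc m) c d alcoves slack λ s → upper s , lower s
    where
    open ≤-Reasoning
    E slack : ℕ
    E = m ! * length quotients
    -- The summand with `E` pays for the degenerate strings in the upper bound, the one with
    -- `alcoves` for replacing the power by the falling factorial in the lower bound.
    slack = (alcoves + E) * gap m
    N : ℕ → ℕ
    N s = length (latticePoints (suc s))
    upper : ∀ s → suc s * (m ! * N s) ≤ suc s * (alcoves * suc s ^ m) + slack * suc s ^ m
    upper s = begin
      t * (m ! * N s)
        ≤⟨ *-monoʳ-≤ t (*-monoʳ-≤ (m !) (≤-trans (|latticePoints|≤ s) (validCount-box≤ s))) ⟩
      t * (m ! * (C s m * alcoves + bad * length quotients))
        ≡⟨ regroup t (m !) (C s m) alcoves bad (length quotients) ⟩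
      t * (alcoves * falling s m) + E * (t * bad)
        ≤⟨ +-mono-≤ (*-monoʳ-≤ t (*-monoʳ-≤ alcoves (falling≤power s m))) (*-monoʳ-≤ E few) ⟩
      t * (alcoves * t ^ m) + E * (gap m * t ^ m)
        ≤⟨ +-monoʳ-≤ (t * (alcoves * t ^ m)) (m≤n+m (E * (gap m * t ^ m)) (alcoves * gap m * t ^ m)) ⟩
      t * (alcoves * t ^ m) + (alcoves * gap m * t ^ m + E * (gap m * t ^ m))
        ≡⟨ cong (_+_ (t * (alcoves * t ^ m))) (collect alcoves E (gap m) (t ^ m)) ⟩
      t * (alcoves * t ^ m) + slack * t ^ m ∎
      where
      t bad : ℕ
      t = suc s
      bad = length (degenerate s)
      few : t * bad ≤ gap m * t ^ m
      few = +-cancelˡ-≤ (t * falling s m) (t * bad) (gap m * t ^ m) (begin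
        t * falling s m + t * bad        ≡⟨ *-distribˡ-+ t (falling s m) bad ⟨
        t * (falling s m + bad)          ≤⟨ *-monoʳ-≤ t (|degenerate|≤ s) ⟩
        t * t ^ m                        ≤⟨ power≤falling s m ⟩
        t * falling s m + gap m * t ^ m  ∎)
      regroup : ∀ t f b a x l → t * (f * (b * a + x * l)) ≡ t * (a * (f * b)) + f * l * (t * x)
      regroup = solve-∀
      collect : ∀ a e g p → a * g * p + e * (g * p) ≡ (a + e) * g * p
      collect = solve-∀
    lower : ∀ s → suc s * (alcoves * suc s ^ m) ≤ suc s * (m ! * N s) + slack * suc s ^ m
    lower s = begin
      t * (alcoves * t ^ m)                                    ≡⟨ swap* t alcoves (t ^ m) ⟩
      alcoves * (t * t ^ m)                                    ≤⟨ *-monoʳ-≤ alcoves (power≤falling s m) ⟩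
      alcoves * (t * falling s m + gap m * t ^ m)              ≡⟨ regroup alcoves t (m !) (C s m) (gap m) (t ^ m) ⟩
      t * (m ! * (C s m * alcoves)) + alcoves * gap m * t ^ m  ≤⟨ +-mono-≤ (*-monoʳ-≤ t (*-monoʳ-≤ (m !) generic))
        (*-monoˡ-≤ (t ^ m) (*-monoˡ-≤ (gap m) (m≤m+n alcoves E))) ⟩
      t * (m ! * N s) + slack * t ^ m                              ∎
      where
      t : ℕ
      t = suc s
      generic : C s m * alcoves ≤ N s
      generic = subst (_≤ N s) (validCount-injectiveDigits s)
        (≤|latticePoints| t (unique-arrangements m (sorted-range s)) (injectiveDigits-digits s))
      swap* : ∀ t a p → t * (a * p) ≡ a * (t * p)
      swap* = solve-∀
      regroup : ∀ a t f b g p → a * (t * (f * b) + g * p) ≡ t * (f * (b * a)) + a * g * p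
      regroup = solve-∀

-- Lifts of circular words

-- Adding multiples on both sides expresses congruence in ℕ without subtraction. The two multipliers
-- are kept as data because periodicity turns them directly into shifts of position, as in `cong-W`.
record Cong (N u v : ℕ) : Set where
  constructor congBy
  field
    a b : ℕ
    proof : u + a * N ≡ v + b * N

module _ {N : ℕ} where

  cong-reflexive : ∀ {u v} → u ≡ v → Cong N u v
  cong-reflexive refl = congBy 0 0 refl

  cong-sym : ∀ {u v} → Cong N u v → Cong N v u
  cong-sym (congBy a b e) = congBy b a (sym e)

  cong-trans : ∀ {u v w} → Cong N u v → Cong N v w → Cong N u w
  cong-trans {u} {v} {w} (congBy a b e) (congBy a′ b′ e′) = congBy (a + a′) (b + b′) (+-cancelˡ-≡ v _ _ (begin
    v + (u + (a + a′) * N)          ≡⟨ regroup v u a a′ N ⟩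
    (u + a * N) + (v + a′ * N)      ≡⟨ cong₂ _+_ e e′ ⟩
    (v + b * N) + (w + b′ * N)      ≡⟨ regroup′ v w b b′ N ⟩
    v + (w + (b + b′) * N)          ∎))
    where
    open ≡-Reasoning
    regroup : ∀ v u a a′ N → v + (u + (a + a′) * N) ≡ (u + a * N) + (v + a′ * N)
    regroup = solve-∀
    regroup′ : ∀ v w b b′ N → (v + b * N) + (w + b′ * N) ≡ v + (w + (b + b′) * N)
    regroup′ = solve-∀

  cong-+ : ∀ {u v u′ v′} → Cong N u v → Cong N u′ v′ → Cong N (u + u′) (v + v′)
  cong-+ {u} {v} {u′} {v′} (congBy a b e) (congBy a′ b′ e′) = congBy (a + a′) (b + b′)
    (trans (regroup u u′ a a′ N) (trans (cong₂ _+_ e e′) (sym (regroup v v′ b b′ N))))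
    where
    regroup : ∀ u u′ a a′ N → u + u′ + (a + a′) * N ≡ u + a * N + (u′ + a′ * N)
    regroup = solve-∀

  cong-*ˡ : ∀ k {u v} → Cong N u v → Cong N (k * u) (k * v)
  cong-*ˡ k {u} {v} (congBy a b e) = congBy (k * a) (k * b) (trans (regroup k u a N) (trans (cong (k *_) e) (sym (regroup k v b N))))
    where
    regroup : ∀ k u a N → k * u + k * a * N ≡ k * (u + a * N)
    regroup = solve-∀

  cong-+-cancelˡ : ∀ k {u v} → Cong N (k + u) (k + v) → Cong N u v
  cong-+-cancelˡ k {u} {v} (congBy a b e) = congBy a b (+-cancelˡ-≡ k _ _
    (trans (sym (+-assoc k u (a * N))) (trans e (+-assoc k v (b * N)))))

  cong-+* : ∀ u k → Cong N (u + k * N) u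
  cong-+* u k = congBy 0 k (+-identityʳ (u + k * N))

  cong⇒%≡ : .{{_ : NonZero N}} → ∀ {u v} → Cong N u v → u % N ≡ v % N
  cong⇒%≡ {u} {v} (congBy a b e) = trans (sym ([m+kn]%n≡m%n u a N)) (trans (cong (_% N) e) ([m+kn]%n≡m%n v b N))

  cong-% : .{{_ : NonZero N}} → ∀ u → Cong N u (u % N)
  cong-% u = congBy 0 (u / N) (trans (+-identityʳ u) (m≡m%n+[m/n]*n u N))

  %≡⇒cong : .{{_ : NonZero N}} → ∀ {u v} → u % N ≡ v % N → Cong N u v
  %≡⇒cong {u} {v} eq = cong-trans (cong-% u) (cong-trans (cong-reflexive eq) (cong-sym (cong-% v)))

  cong<⇒≡ : ∀ {u v} → u < N → v < N → Cong N u v → u ≡ v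
  cong<⇒≡ u<N v<N c = let instance _ = >-nonZero (≤-<-trans z≤n u<N) in
    trans (sym (m<n⇒m%n≡m u<N)) (trans (cong⇒%≡ c) (m<n⇒m%n≡m v<N))

  cong-window : ∀ {y u v} → y ≤ u → u < y + N → y ≤ v → v < y + N → Cong N u v → u ≡ v
  cong-window {y} y≤u u< y≤v v< c with m≤n⇒∃[o]m+o≡n y≤u | m≤n⇒∃[o]m+o≡n y≤v
  ... | u′ , refl | v′ , refl = cong (y +_) (cong<⇒≡ (+-cancelˡ-< y u′ N u<) (+-cancelˡ-< y v′ N v<) (cong-+-cancelˡ y c))

  cong-*ʳ : ∀ {u v} n → Cong N u v → Cong (N * n) (u * n) (v * n)
  cong-*ʳ {u} {v} n (congBy a b e) = congBy a b (trans (regroup u a N n) (trans (cong (_* n) e) (sym (regroup v b N n))))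
    where
    regroup : ∀ u a N n → u * n + a * (N * n) ≡ (u + a * N) * n
    regroup = solve-∀

cong-weaken : ∀ d {n u v} → Cong (d * n) u v → Cong n u v
cong-weaken d {n} {u} {v} (congBy a b e) = congBy (a * d) (b * d)
  (trans (cong (u +_) (*-assoc a d n)) (trans e (cong (v +_) (sym (*-assoc b d n)))))

coprime-inverse : ∀ c d → gcd c d ≡ 1 → ∃ λ c′ → Cong d (c * c′) 1
coprime-inverse c d g with coprime-Bézout (gcd≡1⇒coprime g)
... | Bézout.+- x y e = x , congBy 0 y (trans (+-identityʳ (c * x)) (trans (*-comm c x) (sym e)))
-- If c x ≡ -1 then c (x c x) ≡ 1.
... | Bézout.-+ x y e = x * (c * x) , congBy y (x * c * y) (begin
    c * (x * (c * x)) + y * d                    ≡⟨ cong (c * (x * (c * x)) +_) e ⟨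
    c * (x * (c * x)) + (1 + x * c)              ≡⟨ regroup c x ⟩
    1 + x * c * (1 + x * c)                      ≡⟨ cong (λ u → 1 + x * c * u) e ⟩
    1 + x * c * (y * d)                          ≡⟨ cong suc (*-assoc (x * c) y d) ⟨
    1 + x * c * y * d                            ∎)
  where
  open ≡-Reasoning
  regroup : ∀ c x → c * (x * (c * x)) + (1 + x * c) ≡ 1 + x * c * (1 + x * c)
  regroup = solve-∀

record Slow (N : ℕ) (W : ℕ → ℕ) : Set where
  field
    up : ∀ i → W i ≤ W (suc i)
    below : ∀ i → W (suc i) < W i + N

-- By induction, both next values lie in the window of length N that begins at the common current
-- value, and such a window holds only one representative of each residue class.
slow-unique : ∀ {N A B} → Slow N A → Slow N B → (∀ i → Cong N (A i) (B i)) → A 0 ≡ B 0 → ∀ i → A i ≡ B i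
slow-unique sA sB c eq zero = eq
slow-unique {N} {A} {B} sA sB c eq (suc i) = cong-window (Slow.up sA i) (Slow.below sA i)
  (subst (_≤ B (suc i)) (sym ih) (Slow.up sB i)) (subst (λ y → B (suc i) < y + N) (sym ih) (Slow.below sB i)) (c (suc i))
  where
  ih : A i ≡ B i
  ih = slow-unique sA sB c eq i

-- Descents, rotations and the lift of a word

des : (ℕ → ℕ) → ℕ → ℕ
des f zero = 0
des f (suc k) = lt (f 1) (f 0) + des (f ∘ suc) k

des-suc : ∀ f k → des f (suc k) ≡ des f k + lt (f (suc k)) (f k)
des-suc f zero = +-identityʳ _
des-suc f (suc k) = trans (cong (lt (f 1) (f 0) +_) (des-suc (f ∘ suc) k))
  (sym (+-assoc (lt (f 1) (f 0)) (des (f ∘ suc) k) (lt (f (suc (suc k))) (f (suc k)))))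

des-cong : ∀ {f g} k → (∀ {i} → i ≤ k → f i ≡ g i) → des f k ≡ des g k
des-cong zero h = refl
des-cong (suc k) h = cong₂ _+_ (cong₂ lt (h (s≤s z≤n)) (h z≤n)) (des-cong k (h ∘ s≤s))

linDes≡des : ∀ x xs → linDes (x ∷ xs) ≡ des (at (x ∷ xs)) (length xs)
linDes≡des x [] = refl
linDes≡des x (y ∷ xs) = cong (lt y x +_) (linDes≡des y xs)

cyclicAt : List ℕ → ℕ → ℕ
cyclicAt [] i = 0
cyclicAt w@(_ ∷ _) i = at w (i % length w)

cycDes≡des : ∀ w → cycDes w ≡ des (cyclicAt w) (length w)
cycDes≡des [] = refl
cycDes≡des (x ∷ r) = trans (linDes≡des x (r ++ [ x ]))
  (trans (cong (des (at (x ∷ r ++ [ x ]))) (trans (length-++ r) (+-comm (length r) 1))) (des-cong (suc (length r)) wrap))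
  where
  wrap : ∀ {i} → i ≤ suc (length r) → at (x ∷ r ++ [ x ]) i ≡ cyclicAt (x ∷ r) i
  wrap {i} i≤ with m≤n⇒m<n∨m≡n i≤
  ... | inj₁ i< = trans (at-++ˡ (x ∷ r) i<) (cong (at (x ∷ r)) (sym (m<n⇒m%n≡m i<)))
  ... | inj₂ refl = trans (cong (at (x ∷ r ++ [ x ])) (sym (+-identityʳ (suc (length r)))))
    (trans (at-++ʳ (x ∷ r) {[ x ]} 0) (cong (at (x ∷ r)) (sym (n%n≡0 (suc (length r))))))

at-drop : ∀ k w i → at (drop k w) i ≡ at w (k + i)
at-drop zero w i = refl
at-drop (suc k) [] i = refl
at-drop (suc k) (x ∷ w) i = at-drop k w i

at-take : ∀ {k} w {i} → i < k → at (take k w) i ≡ at w i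
at-take {suc k} [] _ = refl
at-take {suc k} (x ∷ w) {zero} _ = refl
at-take {suc k} (x ∷ w) {suc i} (s≤s p) = at-take w p

length-rotate : ∀ k w → length (rotate k w) ≡ length w
length-rotate zero w = trans (length-++ w) (+-identityʳ (length w))
length-rotate (suc k) [] = refl
length-rotate (suc k) (x ∷ w) = begin
  length (drop k w ++ x ∷ take k w)              ≡⟨ length-++ (drop k w) ⟩
  length (drop k w) + suc (length (take k w))    ≡⟨ +-suc (length (drop k w)) (length (take k w)) ⟩
  suc (length (drop k w) + length (take k w))    ≡⟨ cong suc (length-++ (drop k w)) ⟨
  suc (length (rotate k w))                      ≡⟨ cong suc (length-rotate k w) ⟩
  suc (length w)                                 ∎
  where open ≡-Reasoning

at-rotate : ∀ {k w i} .{{_ : NonZero (length w)}} → k < length w → i < length w → at (rotate k w) i ≡ at w ((i + k) % length w)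
at-rotate {k} {w} {i} k<l i<l with i + k <? length w
... | yes i+k< = trans (at-++ˡ (drop k w) (subst (i <_) (sym (length-drop k w)) (m+n≤o⇒m≤o∸n (suc i) i+k<)))
  (trans (at-drop k w i) (cong (at w) (trans (+-comm k i) (sym (m<n⇒m%n≡m i+k<)))))
... | no i+k≮ with m≤n⇒∃[o]m+o≡n (≮⇒≥ i+k≮)
...   | j , eq = begin
  at (drop k w ++ take k w) i                            ≡⟨ cong (at (drop k w ++ take k w)) i≡ ⟩
  at (drop k w ++ take k w) (length (drop k w) + j)      ≡⟨ at-++ʳ (drop k w) j ⟩
  at (take k w) j                                        ≡⟨ at-take w j<k ⟩
  at w j                                                 ≡⟨ cong (at w) (m<n⇒m%n≡m (<-trans j<k k<l)) ⟨
  at w (j % length w)                                    ≡⟨ cong (at w) ([m+n]%n≡m%n j (length w)) ⟨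
  at w ((j + length w) % length w)                       ≡⟨ cong (λ u → at w (u % length w)) (trans (+-comm j (length w)) eq) ⟩
  at w ((i + k) % length w)                              ∎
  where
  open ≡-Reasoning
  j<k : j < k
  j<k = +-cancelˡ-< (length w) j k (subst (_< length w + k) (sym eq) (+-monoˡ-< k i<l))
  i≡ : i ≡ length (drop k w) + j
  i≡ = +-cancelˡ-≡ k i _ (trans (+-comm k i) (trans (sym eq) (trans (cong (_+ j) (sym k+drop)) (+-assoc k (length (drop k w)) j))))
    where
    k+drop : k + length (drop k w) ≡ length w
    k+drop = trans (cong (k +_) (length-drop k w)) (m+[n∸m]≡n (<⇒≤ k<l))

lift : List ℕ → ℕ → ℕ
lift w i = cyclicAt w i + des (cyclicAt w) i * length w

cong-lift : ∀ w i → Cong (length w) (lift w i) (cyclicAt w i)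
cong-lift w i = cong-+* (cyclicAt w i) (des (cyclicAt w) i)

-- At a descent the added N outweighs the drop of the letter, which is less than N, and leaves a
-- step below N. Elsewhere the step is the rise of the letter, again below N.
lift-slow : ∀ w → (∀ i → cyclicAt w i < length w) → Slow (length w) (lift w)
lift-slow w a< = record { up = λ i → proj₁ (step i) ; below = λ i → proj₂ (step i) }
  where
  N : ℕ
  N = length w
  step : ∀ i → lift w i ≤ lift w (suc i) × lift w (suc i) < lift w i + N
  step i rewrite des-suc (cyclicAt w) i with lt-view (cyclicAt w (suc i)) (cyclicAt w i)
  ... | inj₁ (lower , eq) rewrite eq = ≤-trans (+-monoˡ-≤ (D * N) (<⇒≤ (a< i)))
          (≤-trans (≤-reflexive (regroup N D)) (m≤n+m ((D + 1) * N) (cyclicAt w (suc i)))) ,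
        <-≤-trans (+-monoˡ-< ((D + 1) * N) lower) (≤-reflexive (regroup′ (cyclicAt w i) N D))
    where
    D : ℕ
    D = des (cyclicAt w) i
    regroup : ∀ N D → N + D * N ≡ (D + 1) * N
    regroup = solve-∀
    regroup′ : ∀ a N D → a + (D + 1) * N ≡ a + D * N + N
    regroup′ = solve-∀
  ... | inj₂ (higher , eq) rewrite eq | +-identityʳ (des (cyclicAt w) i) = +-monoˡ-≤ (D * N) higher ,
        <-≤-trans (+-monoˡ-< (D * N) (a< (suc i))) (≤-trans (≤-reflexive (+-comm N (D * N))) (+-monoˡ-≤ N (m≤n+m (D * N) (cyclicAt w i))))
    where
    D : ℕ
    D = des (cyclicAt w) i

-- Fixed circular permutations and alcoves

cyclicAt-% : ∀ {N} .{{_ : NonZero N}} w → length w ≡ N → ∀ i → cyclicAt w i ≡ at w (i % N)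
cyclicAt-% [] _ i = refl
cyclicAt-% (x ∷ w) refl i = refl

sameCirc⁻ : ∀ {u} w → T (sameCirc u w) → ∃ λ k → k < length w × rotate k w ≡ u
sameCirc⁻ {u} w same with find (Any.any⁻ (λ k → rotate k w ==ᴸ u) (upTo (length w)) same)
... | k , k∈ , eq = k , ∈-upTo⁻ k∈ , toWitness eq

sameCirc⁺ : ∀ {u} w {k} → k < length w → rotate k w ≡ u → T (sameCirc u w)
sameCirc⁺ {u} w k< eq = Any.any⁺ (λ k → rotate k w ==ᴸ u) (lose (∈-upTo⁺ k<) (fromWitness eq))

at-shiftWord : ∀ s N .{{_ : NonZero N}} w {i} → i < length w → at (shiftWord s N w) i ≡ (at w i + s) % N
at-shiftWord s N (x ∷ w) {zero} _ = refl
at-shiftWord s N (x ∷ w) {suc i} (s≤s p) = at-shiftWord s N w p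

module Correspondence (c d m M : ℕ) (N≡dn : suc M ≡ d * suc m) (0<c : 0 < c) (c<N : c < suc M) (coprime : gcd c d ≡ 1) where
  open Walk c d m
  open Volume c d m using (pairs; unique-pairs; ∈-pairs⁺; ∈-pairs⁻; alcoves)

  n N : ℕ
  n = suc m
  N = suc M

  toN : ∀ {u v} → Cong (d * n) u v → Cong N u v
  toN {u} {v} = subst (λ N → Cong N u v) (sym N≡dn)

  N→n : ∀ {u v} → Cong N u v → Cong n u v
  N→n {u} {v} = cong-weaken d ∘ subst (λ N → Cong N u v) N≡dn

  c⁻¹ : ℕ
  c⁻¹ = proj₁ (coprime-inverse c d coprime)

  -- A congruence modulo d, multiplied by n, becomes one modulo d n = N. In effect, moving by k c⁻¹
  -- blocks of n positions changes a winding by k n modulo N.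
  cong-c⁻¹ : ∀ k → Cong N (k * c⁻¹ * (c * n)) (k * n)
  cong-c⁻¹ k = cong-trans (cong-reflexive (regroup k c⁻¹ c n))
    (toN (cong-*ʳ n (cong-trans (cong-*ˡ k (proj₂ (coprime-inverse c d coprime))) (cong-reflexive (*-identityʳ k)))))
    where
    regroup : ∀ k c′ c n → k * c′ * (c * n) ≡ k * (c * c′) * n
    regroup = solve-∀

  -- The lift W of a circular word: W i mod N is the i-th letter, and W i div N counts the cyclic descents before it.
  record Winding (W : ℕ → ℕ) : Set where
    field
      start : W 0 ≡ 0
      slow : Slow N W
      periodic : ∀ i → W (i + n) ≡ W i + c * n
      residues : ∀ {i j} → Cong n (W i) (W j) → Cong n i j
    open Slow slow public

    periodic* : ∀ i k → W (i + k * n) ≡ W i + k * (c * n)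
    periodic* i zero = trans (cong W (+-identityʳ i)) (sym (+-identityʳ (W i)))
    periodic* i (suc k) = begin
      W (i + (n + k * n))              ≡⟨ cong W (+-assoc i n (k * n)) ⟨
      W (i + n + k * n)                ≡⟨ periodic* (i + n) k ⟩
      W (i + n) + k * (c * n)          ≡⟨ cong (_+ k * (c * n)) (periodic i) ⟩
      W i + c * n + k * (c * n)        ≡⟨ +-assoc (W i) (c * n) (k * (c * n)) ⟩
      W i + (c * n + k * (c * n))      ∎
      where open ≡-Reasoning

    full-turns : ∀ i k → W (i + k * N) ≡ W i + k * c * N
    full-turns i k = begin
      W (i + k * N)               ≡⟨ cong (λ N → W (i + k * N)) N≡dn ⟩
      W (i + k * (d * n))         ≡⟨ cong (λ e → W (i + e)) (*-assoc k d n) ⟨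
      W (i + k * d * n)           ≡⟨ periodic* i (k * d) ⟩
      W i + k * d * (c * n)       ≡⟨ cong (W i +_) (regroup k d c n) ⟩
      W i + k * c * (d * n)       ≡⟨ cong (λ N → W i + k * c * N) N≡dn ⟨
      W i + k * c * N             ∎
      where
      open ≡-Reasoning
      regroup : ∀ k d c n → k * d * (c * n) ≡ k * c * (d * n)
      regroup = solve-∀

    cong-W : ∀ {i j} → Cong N i j → Cong N (W i) (W j)
    cong-W {i} {j} (congBy a b e) = congBy (a * c) (b * c) (trans (sym (full-turns i a)) (trans (cong W e) (full-turns j b)))

    walk : IsWalk n W
    walk = record
      { start = start
      ; end = trans (periodic 0) (cong (_+ c * n) start)
      ; up = λ {i} _ → up i
      ; bounded = λ {i} _ → subst (λ N → W (suc i) ≤ W i + N) N≡dn (<⇒≤ (below i))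
      }

  winding-unique : ∀ {W W′} → Winding W → Winding W′ → (∀ {i} → i ≤ m → W i ≡ W′ i) → ∀ i → W i ≡ W′ i
  winding-unique {W} {W′} w w′ eq i = begin
    W i                              ≡⟨ cong W (m≡m%n+[m/n]*n i n) ⟩
    W (i % n + i / n * n)            ≡⟨ Winding.periodic* w (i % n) (i / n) ⟩
    W (i % n) + i / n * (c * n)      ≡⟨ cong (_+ i / n * (c * n)) (eq (s≤s⁻¹ (m%n<n i n))) ⟩
    W′ (i % n) + i / n * (c * n)     ≡⟨ Winding.periodic* w′ (i % n) (i / n) ⟨
    W′ (i % n + i / n * n)           ≡⟨ cong W′ (m≡m%n+[m/n]*n i n) ⟨
    W′ i                             ∎
    where open ≡-Reasoning

  record IsWord (w : List ℕ) : Set where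
    field
      len : length w ≡ N
      head : at w 0 ≡ 0
      unique : Unique w
      bound : ∀ i → at w i < N

    letters : ∀ i → cyclicAt w i ≡ at w (i % N)
    letters = cyclicAt-% w len

    letter< : ∀ i → cyclicAt w i < N
    letter< i = subst (_< N) (sym (letters i)) (bound (i % N))

    letter-injective : ∀ {i j} → cyclicAt w i ≡ cyclicAt w j → Cong N i j
    letter-injective {i} {j} eq = %≡⇒cong (at-injective unique (index i) (index j) (trans (sym (letters i)) (trans eq (letters j))))
      where
      index : ∀ i → i % N < length w
      index i = subst (i % N <_) (sym len) (m%n<n i N)

    letter-cong : ∀ {i j} → Cong N i j → cyclicAt w i ≡ cyclicAt w j
    letter-cong {i} {j} e = trans (letters i) (trans (cong (at w) (cong⇒%≡ e)) (sym (letters j)))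

    lift-N-slow : Slow N (lift w)
    lift-N-slow = subst (λ l → Slow l (lift w)) len (lift-slow w λ i → subst (cyclicAt w i <_) (sym len) (letter< i))

    lift≈letter : ∀ i → Cong N (lift w i) (cyclicAt w i)
    lift≈letter i = subst (λ l → Cong l (lift w i) (cyclicAt w i)) len (cong-lift w i)

    lift-zero : lift w 0 ≡ 0
    lift-zero = trans (+-identityʳ (cyclicAt w 0)) (trans (letters 0) head)

    lift-N : lift w N ≡ cycDes w * N
    lift-N = cong₂ _+_ (trans (letters N) (trans (cong (at w) (n%n≡0 N)) head))
      (cong₂ _*_ (trans (cong (des (cyclicAt w)) (sym len)) (sym (cycDes≡des w))) len)

    lift-injective : ∀ {i j} → Cong N (lift w i) (lift w j) → Cong N i j
    lift-injective {i} {j} e = letter-injective (cong<⇒≡ (letter< i) (letter< j)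
      (cong-trans (cong-sym (lift≈letter i)) (cong-trans e (lift≈letter j))))

    lift-cong : ∀ {i j} → Cong N i j → Cong N (lift w i) (lift w j)
    lift-cong {i} {j} e = cong-trans (lift≈letter i) (cong-trans (cong-reflexive (letter-cong e)) (cong-sym (lift≈letter j)))

  open IsWord

  circPerms⇒word : ∀ {w} → w ∈ circPerms M → IsWord w
  circPerms⇒word w∈ with ∈-map⁻ (0 ∷_) w∈
  ... | v , v∈ , refl = record
    { len = cong suc (trans (↭-length v↭) (length-range M))
    ; head = refl
    ; unique = All.tabulate (λ y∈ → <⇒≢ (proj₁ (∈-range⁻ (∈-resp-↭ v↭ y∈)))) ∷ unique-resp-↭ (↭-sym v↭) (sorted⇒unique (sorted-range M))
    ; bound = bound′
    }
    where
    v↭ : v ↭ range M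
    v↭ = ∈-perms⇒↭ (range M) v∈
    bound′ : ∀ i → at (0 ∷ v) i < N
    bound′ zero = z<s
    bound′ (suc i) with i <? length v
    ... | yes i< = s≤s (proj₂ (∈-range⁻ (∈-resp-↭ v↭ (at∈ v i<))))
    ... | no i≮ = subst (_< N) (sym (at-beyond v (≮⇒≥ i≮))) z<s

  word⇒circPerms : ∀ {w} → IsWord w → w ∈ circPerms M
  word⇒circPerms {[]} word with len word
  ... | ()
  word⇒circPerms {x ∷ v} word with head word | unique word
  ... | refl | 0∉ ∷ u = ∈-map⁺ (0 ∷_) (unique⊆⇒∈-perms (range M) u (trans (suc-injective (len word)) (sym (length-range M)))
    λ {y} y∈ → let i , _ , eq = ∈⇒at y∈ in
      ∈-range⁺ (n≢0⇒n>0 (All.lookup 0∉ y∈ ∘ sym)) (s≤s⁻¹ (subst (_< N) (sym eq) (bound word (suc i)))))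

  record IsFixed (w : List ℕ) : Set where
    field
      word : IsWord w
      descents : cycDes w ≡ c
      rotation : ∃ λ k → k < length w × rotate k w ≡ shiftWord n N w

  fixedWords : List (List ℕ)
  fixedWords = filterᵇ (λ w → (cycDes w ≡ᵇ c) ∧ sameCirc (shiftWord n N w) w) (circPerms M)

  ∈-fixedWords⁻ : ∀ {w} → w ∈ fixedWords → IsFixed w
  ∈-fixedWords⁻ {w} w∈ with ∈-filter⁻ (T? ∘ λ w → (cycDes w ≡ᵇ c) ∧ sameCirc (shiftWord n N w) w) {xs = circPerms M} w∈
  ... | w∈′ , t = let t₁ , t₂ = Equivalence.to T-∧ t in
    record { word = circPerms⇒word w∈′ ; descents = ≡ᵇ⇒≡ (cycDes w) c t₁ ; rotation = sameCirc⁻ w t₂ }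

  ∈-fixedWords⁺ : ∀ {w} → IsFixed w → w ∈ fixedWords
  ∈-fixedWords⁺ {w} fixed = let k , k< , eq = IsFixed.rotation fixed in
    ∈-filter⁺ (T? ∘ λ w → (cycDes w ≡ᵇ c) ∧ sameCirc (shiftWord n N w) w) (word⇒circPerms (IsFixed.word fixed))
      (Equivalence.from T-∧ (≡⇒≡ᵇ (cycDes w) c (IsFixed.descents fixed) , sameCirc⁺ w k< eq))

  unique-fixedWords : Unique fixedWords
  unique-fixedWords = Unique.filter⁺ (T? ∘ λ w → (cycDes w ≡ᵇ c) ∧ sameCirc (shiftWord n N w) w)
    (Unique.map⁺ ∷-injectiveʳ (unique-perms (range M) (sorted⇒unique (sorted-range M))))

  -- The lift of a fixed circular permutation

  module _ {w : List ℕ} (fixed : IsFixed w) where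
    open IsFixed fixed

    private
      W : ℕ → ℕ
      W = lift w

    -- A number by which all differences W (i + e) - W i are constant; slowness reduces this to a congruence.
    Period : ℕ → Set
    Period e = ∀ i → W (i + e) ≡ W i + W e

    period-by-cong : ∀ e → (∀ i → Cong N (W (i + e)) (W i + W e)) → Period e
    period-by-cong e h = slow-unique
      (record { up = λ i → Slow.up s (i + e) ; below = λ i → Slow.below s (i + e) })
      (record { up = λ i → +-monoˡ-≤ (W e) (Slow.up s i)
              ; below = λ i → <-≤-trans (+-monoˡ-< (W e) (Slow.below s i)) (≤-reflexive (regroup (W i) N (W e))) })
      h (sym (cong (_+ W e) (lift-zero word)))
      where
      s : Slow N W
      s = lift-N-slow word
      regroup : ∀ a N b → a + N + b ≡ a + b + N
      regroup = solve-∀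

    period* : ∀ {e} → Period e → ∀ i k → W (i + k * e) ≡ W i + k * W e
    period* {e} p i zero = trans (cong W (+-identityʳ i)) (sym (+-identityʳ (W i)))
    period* {e} p i (suc k) = begin
      W (i + (e + k * e))          ≡⟨ cong W (+-assoc i e (k * e)) ⟨
      W (i + e + k * e)            ≡⟨ period* p (i + e) k ⟩
      W (i + e) + k * W e          ≡⟨ cong (_+ k * W e) (p i) ⟩
      W i + W e + k * W e          ≡⟨ +-assoc (W i) (W e) (k * W e) ⟩
      W i + (W e + k * W e)        ∎
      where open ≡-Reasoning

    W-N : W N ≡ c * N
    W-N = trans (lift-N word) (cong (_* N) descents)

    period-N : Period N
    period-N = period-by-cong N λ i → cong-trans (lift-cong word (cong-trans (cong-reflexive (cong (i +_) (sym (*-identityˡ N)))) (cong-+* i 1)))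
      (cong-sym (cong-trans (cong-reflexive (cong (W i +_) W-N)) (cong-+* (W i) c)))

    k : ℕ
    k = proj₁ rotation

    rotated : ∀ i → Cong N (W (i + k)) (W i + n)
    rotated i = cong-trans (lift≈letter word (i + k)) (cong-trans (%≡⇒cong eq)
      (cong-+ (cong-sym (lift≈letter word i)) (cong-reflexive refl)))
      where
      open ≡-Reasoning
      i< : i % N < length w
      i< = subst (i % N <_) (sym (len word)) (m%n<n i N)
      instance
        l≢0 : NonZero (length w)
        l≢0 = >-nonZero (≤-<-trans z≤n i<)
      eq : cyclicAt w (i + k) % N ≡ (cyclicAt w i + n) % N
      eq = begin
        cyclicAt w (i + k) % N                 ≡⟨ cong (_% N) (letter-cong word (cong-+ (cong-% i) (cong-reflexive refl))) ⟩
        cyclicAt w (i % N + k) % N             ≡⟨ cong (_% N) (cyclicAt-% w refl (i % N + k)) ⟩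
        at w ((i % N + k) % length w) % N      ≡⟨ cong (_% N) (at-rotate {k} {w} (proj₁ (proj₂ rotation)) i<) ⟨
        at (rotate k w) (i % N) % N            ≡⟨ cong (λ u → at u (i % N) % N) (proj₂ (proj₂ rotation)) ⟩
        at (shiftWord n N w) (i % N) % N       ≡⟨ cong (_% N) (at-shiftWord n N w i<) ⟩
        (at w (i % N) + n) % N % N             ≡⟨ m%n%n≡m%n (at w (i % N) + n) N ⟩
        (at w (i % N) + n) % N                 ≡⟨ cong (λ u → (u + n) % N) (letters word i) ⟨
        (cyclicAt w i + n) % N                 ∎

    Wk≈n : Cong N (W k) n
    Wk≈n = cong-trans (rotated 0) (cong-reflexive (cong (_+ n) (lift-zero word)))

    period-k : Period k
    period-k = period-by-cong k λ i → cong-trans (rotated i) (cong-+ (cong-reflexive refl) (cong-sym Wk≈n))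

    -- W (k N) is computed with either of the two periods k and N.
    Wk≡ck : W k ≡ c * k
    Wk≡ck = *-cancelˡ-≡ (W k) (c * k) N (begin
      N * W k              ≡⟨ cong (_+ N * W k) (lift-zero word) ⟨
      W 0 + N * W k        ≡⟨ period* period-k 0 N ⟨
      W (N * k)            ≡⟨ cong W (*-comm N k) ⟩
      W (k * N)            ≡⟨ period* period-N 0 k ⟩
      W 0 + k * W N        ≡⟨ cong₂ _+_ (lift-zero word) (cong (k *_) W-N) ⟩
      k * (c * N)          ≡⟨ regroup k c N ⟩
      N * (c * k)          ∎)
      where
      open ≡-Reasoning
      regroup : ∀ k c N → k * (c * N) ≡ N * (c * k)
      regroup = solve-∀

    -- n is congruent to the multiple c k of the period k modulo the period N.
    lift-periodic : ∀ i → W (i + n) ≡ W i + c * n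
    lift-periodic i = from (cong-trans (cong-reflexive (sym Wk≡ck)) Wk≈n)
      where
      open ≡-Reasoning
      regroup : ∀ w c k a N → w + c * (c * k) + a * (c * N) ≡ w + c * (c * k + a * N)
      regroup = solve-∀
      regroup′ : ∀ w c n b N → w + c * (n + b * N) ≡ w + c * n + b * (c * N)
      regroup′ = solve-∀
      from : Cong N (c * k) n → W (i + n) ≡ W i + c * n
      from (congBy a b e) = +-cancelʳ-≡ (b * (c * N)) (W (i + n)) (W i + c * n) (begin
        W (i + n) + b * (c * N)              ≡⟨ cong (λ u → W (i + n) + b * u) W-N ⟨
        W (i + n) + b * W N                  ≡⟨ period* period-N (i + n) b ⟨
        W (i + n + b * N)                    ≡⟨ cong W (+-assoc i n (b * N)) ⟩
        W (i + (n + b * N))                  ≡⟨ cong (λ u → W (i + u)) e ⟨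
        W (i + (c * k + a * N))              ≡⟨ cong W (+-assoc i (c * k) (a * N)) ⟨
        W (i + c * k + a * N)                ≡⟨ period* period-N (i + c * k) a ⟩
        W (i + c * k) + a * W N              ≡⟨ cong₂ _+_ (period* period-k i c) (cong (a *_) W-N) ⟩
        W i + c * W k + a * (c * N)          ≡⟨ cong (λ u → W i + c * u + a * (c * N)) Wk≡ck ⟩
        W i + c * (c * k) + a * (c * N)      ≡⟨ regroup (W i) c k a N ⟩
        W i + c * (c * k + a * N)            ≡⟨ cong (λ u → W i + c * u) e ⟩
        W i + c * (n + b * N)                ≡⟨ regroup′ (W i) c n b N ⟩
        W i + c * n + b * (c * N)            ∎)

    -- Moving i by a c⁻¹ n positions changes W i by a n modulo N.
    lift-residues : ∀ {i j} → Cong n (W i) (W j) → Cong n i j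
    lift-residues {i} {j} (congBy a b e) = cong-trans (cong-sym (cong-+* i (a * c⁻¹)))
      (cong-trans (N→n (lift-injective word (cong-trans (move i a) (cong-trans (cong-reflexive e) (cong-sym (move j b))))))
        (cong-+* j (b * c⁻¹)))
      where
      p* : ∀ i k → W (i + k * n) ≡ W i + k * (c * n)
      p* i k = trans (period* period-n i k) (cong (λ u → W i + k * u) W-n)
        where
        W-n : W n ≡ c * n
        W-n = trans (lift-periodic 0) (cong (_+ c * n) (lift-zero word))
        period-n : Period n
        period-n i = trans (lift-periodic i) (cong (W i +_) (sym W-n))
      move : ∀ i a → Cong N (W (i + a * c⁻¹ * n)) (W i + a * n)
      move i a = cong-trans (cong-reflexive (p* i (a * c⁻¹))) (cong-+ (cong-reflexive refl) (cong-c⁻¹ a))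

    lift-winding : Winding W
    lift-winding = record { start = lift-zero word ; slow = lift-N-slow word ; periodic = lift-periodic ; residues = lift-residues }

  alcove : List ℕ → List ℕ × List ℕ
  alcove w = encode n (lift w)

  -- By `residues` the values at 0, ..., m are distinct modulo n, and the value at 0 is 0. So the
  -- remaining m digits are distinct and nonzero below n, which makes them a permutation of 1, ...,
  -- m.
  alcove∈pairs : ∀ {w} → IsFixed w → alcove w ∈ pairs (perms (range m))
  alcove∈pairs {w} fixed = ∈-pairs⁺ r∈ (encode-quotients n walk) (encode-valid n walk)
    where
    open Winding (lift-winding fixed)
    W : ℕ → ℕ
    W = lift w
    r∈ : proj₁ (alcove w) ∈ perms (range m)
    r∈ = unique⊆⇒∈-perms (range m)
      (Unique.applyUpTo⁺₁ (λ i → W (suc i) % n) m λ {i} {j} i<j j<m eq →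
        <⇒≢ (s<s i<j) (cong<⇒≡ (s<s (<-trans i<j j<m)) (s<s j<m) (residues (%≡⇒cong eq))))
      (trans (length-applyUpTo (λ i → W (suc i) % n) m) (sym (length-range m)))
      inRange
      where
      inRange : ∀ {y} → y ∈ proj₁ (alcove w) → y ∈ range m
      inRange y∈ with ∈-applyUpTo⁻ (λ i → W (suc i) % n) y∈
      ... | i , i<m , refl = ∈-range⁺ (n≢0⇒n>0 λ eq → 1+n≢0 (cong<⇒≡ (s<s i<m) z<s
              (residues (%≡⇒cong (trans eq (sym (cong (_% n) start)))))))
        (s≤s⁻¹ (m%n<n (W (suc i)) n))

  -- The pair determines the lift on one block of n positions, periodicity extends this to all
  -- positions, and the letters are the residues of the lift modulo N.
  alcove-injective : ∀ {w w′} → IsFixed w → IsFixed w′ → alcove w ≡ alcove w′ → w ≡ w′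
  alcove-injective {w} {w′} fixed fixed′ eq = at-ext (trans (len word) (sym (len word′))) λ {i} i< →
    let i<N = subst (i <_) (len word) i< in begin
      at w i               ≡⟨ cong (at w) (m<n⇒m%n≡m i<N) ⟨
      at w (i % N)         ≡⟨ letters word i ⟨
      cyclicAt w i         ≡⟨ cong<⇒≡ (letter< word i) (letter< word′ i) (cong-trans (cong-sym (lift≈letter word i))
                                (cong-trans (cong-reflexive (same i)) (lift≈letter word′ i))) ⟩
      cyclicAt w′ i        ≡⟨ letters word′ i ⟩
      at w′ (i % N)        ≡⟨ cong (at w′) (m<n⇒m%n≡m i<N) ⟩
      at w′ i              ∎
    where
    open ≡-Reasoning
    word : IsWord w
    word = IsFixed.word fixed
    word′ : IsWord w′
    word′ = IsFixed.word fixed′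
    same : ∀ i → lift w i ≡ lift w′ i
    same = winding-unique (lift-winding fixed) (lift-winding fixed′) λ i≤m →
      encode-injective n (Winding.walk (lift-winding fixed)) (Winding.walk (lift-winding fixed′)) eq (m≤n⇒m≤1+n i≤m)

  -- The fixed circular permutation of a valid pair

  1≢0-mod-N : ¬ Cong N 1 0
  1≢0-mod-N e = 1+n≢0 (cong<⇒≡ (≤-<-trans 0<c c<N) z<s e)

  extend : List ℕ × List ℕ → ℕ → ℕ
  extend rq i = position n rq (i % n) + i / n * (c * n)

  module _ {rq : List ℕ × List ℕ} (rq∈ : rq ∈ pairs (perms (range m))) where
    private
      r = proj₁ rq
      q = proj₂ rq
      W = extend rq
      r↭ : r ↭ range m
      r↭ = ∈-perms⇒↭ (range m) (proj₁ (∈-pairs⁻ (perms (range m)) rq∈))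

    |q| : length q ≡ m
    |q| = proj₁ (∈-box⁻ m c (proj₁ (proj₂ (∈-pairs⁻ (perms (range m)) rq∈))))

    |r| : length r ≡ m
    |r| = trans (↭-length r↭) (length-range m)

    r< : ∀ i → at r i < n
    r< i with i <? length r
    ... | yes i< = s≤s (proj₂ (∈-range⁻ (∈-resp-↭ r↭ (at∈ r i<))))
    ... | no i≮ = subst (_< n) (sym (at-beyond r (≮⇒≥ i≮))) z<s

    position-isWalk : IsWalk n (position n rq)
    position-isWalk = position-walk n |r| |q| r< (proj₂ (proj₂ (∈-pairs⁻ (perms (range m)) rq∈)))

    open IsWalk position-isWalk using () renaming (end to position-end; up to position-up; bounded to position-bounded)

    -- The end of one block is the start of the next because the walk ends at c n. Including i = n
    -- lets a step across a block boundary be treated like any other, as `next-block` does.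
    extend-block : ∀ {i} k → i ≤ n → W (i + k * n) ≡ position n rq i + k * (c * n)
    extend-block {i} k i≤n with m≤n⇒m<n∨m≡n i≤n
    ... | inj₁ i<n = cong₂ (λ u v → position n rq u + v * (c * n)) (digits-% k i<n) (digits-/ k i<n)
    ... | inj₂ refl = trans (cong₂ (λ u v → position n rq u + v * (c * n)) (m*n%n≡0 (suc k) n) (m*n/n≡m (suc k) n))
      (cong (_+ k * (c * n)) (sym position-end))

    extend-position : ∀ {i} → i ≤ n → W i ≡ position n rq i
    extend-position {i} i≤n = trans (cong W (sym (+-identityʳ i))) (trans (extend-block 0 i≤n) (+-identityʳ (position n rq i)))

    -- Modulo n the value at i is the digit of i % n, since quotients and block shifts contribute
    -- multiples of n; and the n digits in `0 ∷ r` are distinct.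
    extend-residues : ∀ {i j} → Cong n (W i) (W j) → Cong n i j
    extend-residues {i} {j} e = %≡⇒cong (at-injective {0 ∷ r} unique-0∷r (index i) (index j)
      (cong<⇒≡ (rem< n {r} {q} |r| |q| r< (i % n)) (rem< n {r} {q} |r| |q| r< (j % n))
        (cong-trans (cong-sym (digit i)) (cong-trans e (digit j)))))
      where
      unique-0∷r : Unique (0 ∷ r)
      unique-0∷r = All.tabulate (λ y∈ → <⇒≢ (proj₁ (∈-range⁻ (∈-resp-↭ r↭ y∈)))) ∷ unique-resp-↭ (↭-sym r↭) (sorted⇒unique (sorted-range m))
      index : ∀ i → i % n < length (0 ∷ r)
      index i = subst (λ l → i % n < suc l) (sym |r|) (m%n<n i n)
      digit : ∀ i → Cong n (W i) (rem r (i % n))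
      digit i = cong-trans (cong-reflexive (cong (position n rq (i % n) +_) (sym (*-assoc (i / n) c n))))
        (cong-trans (cong-+* (position n rq (i % n)) (i / n * c)) (cong-+* (rem r (i % n)) (quot q (i % n))))

    extend-periodic* : ∀ i k → W (i + k * n) ≡ W i + k * (c * n)
    extend-periodic* i k = begin
      W (i + k * n)                                      ≡⟨ cong (λ u → W (u + k * n)) (m≡m%n+[m/n]*n i n) ⟩
      W (i % n + i / n * n + k * n)                      ≡⟨ cong W (regroup (i % n) (i / n) k n) ⟩
      W (i % n + (i / n + k) * n)                        ≡⟨ extend-block (i / n + k) (<⇒≤ (m%n<n i n)) ⟩
      position n rq (i % n) + (i / n + k) * (c * n)      ≡⟨ regroup (position n rq (i % n)) (i / n) k (c * n) ⟨
      W i + k * (c * n)                                  ∎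
      where
      open ≡-Reasoning
      regroup : ∀ a b k n → a + b * n + k * n ≡ a + (b + k) * n
      regroup = solve-∀

    -- Reduction modulo n gives i + a n = j + b n. Evaluating W at this common position yields a c n
    -- ≡ b c n modulo N, and multiplication by c⁻¹ gives a n ≡ b n, whence i ≡ j.
    extend-residues-N : ∀ {i j} → Cong N (W i) (W j) → Cong N i j
    extend-residues-N {i} {j} e = from (extend-residues (N→n e))
      where
      shuffle : ∀ x c n y → x * y * (c * n) ≡ y * (x * (c * n))
      shuffle = solve-∀
      from : Cong n i j → Cong N i j
      from (congBy a b eq) = cong-+-cancelˡ (a * n) (cong-trans (cong-reflexive (trans (+-comm (a * n) i) eq))
        (cong-trans (cong-+ (cong-reflexive refl) (cong-sym multiples)) (cong-reflexive (+-comm j (a * n)))))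
        where
        shifts : Cong N (a * (c * n)) (b * (c * n))
        shifts = cong-+-cancelˡ (W i) (cong-trans
          (cong-reflexive (trans (sym (extend-periodic* i a)) (trans (cong W eq) (extend-periodic* j b))))
          (cong-+ (cong-sym e) (cong-reflexive refl)))
        multiples : Cong N (a * n) (b * n)
        multiples = cong-trans (cong-sym (cong-c⁻¹ a)) (cong-trans (cong-reflexive (shuffle a c n c⁻¹))
          (cong-trans (cong-*ˡ c⁻¹ shifts) (cong-trans (cong-reflexive (sym (shuffle b c n c⁻¹))) (cong-c⁻¹ b))))

    -- Validity bounds a step only weakly by d n = N. A step of exactly N would make W i and W (i +
    -- 1) congruent modulo N, hence also i and i + 1, which N > 1 forbids.
    extend-slow : Slow N W
    extend-slow = record
      { up = λ i → subst₂ _≤_ (sym (here-block i)) (sym (next-block i)) (+-monoˡ-≤ (i / n * (c * n)) (position-up (m%n<n i n)))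
      ; below = λ i → ≤∧≢⇒< (weakly-below i) λ eq → 1≢0-mod-N (cong-+-cancelˡ i
          (cong-trans (cong-reflexive (+-comm i 1)) (cong-trans (extend-residues-N (cong-trans (cong-reflexive eq)
            (cong-trans (cong-reflexive (cong (W i +_) (sym (*-identityˡ N)))) (cong-+* (W i) 1))))
            (cong-reflexive (sym (+-identityʳ i))))))
      }
      where
      here-block : ∀ i → W i ≡ position n rq (i % n) + i / n * (c * n)
      here-block i = refl
      next-block : ∀ i → W (suc i) ≡ position n rq (suc (i % n)) + i / n * (c * n)
      next-block i = trans (cong (W ∘ suc) (m≡m%n+[m/n]*n i n)) (extend-block (i / n) (m%n<n i n))
      regroup : ∀ a b e → a + b + e ≡ a + e + b
      regroup = solve-∀
      weakly-below : ∀ i → W (suc i) ≤ W i + N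
      weakly-below i = subst₂ _≤_ (sym (next-block i))
        (trans (regroup (position n rq (i % n)) (d * n) (i / n * (c * n))) (cong (W i +_) (sym N≡dn)))
        (+-monoˡ-≤ (i / n * (c * n)) (position-bounded (m%n<n i n)))

    extend-winding : Winding W
    extend-winding = record
      { start = refl
      ; slow = extend-slow
      ; periodic = λ i → trans (cong (λ u → W (i + u)) (sym (*-identityˡ n))) (trans (extend-periodic* i 1) (cong (W i +_) (*-identityˡ (c * n))))
      ; residues = extend-residues
      }

    open Winding extend-winding using (cong-W; full-turns)

    fixedWord : List ℕ
    fixedWord = applyUpTo (λ i → W i % N) N

    fixedWord-isWord : IsWord fixedWord
    fixedWord-isWord = record
      { len = length-applyUpTo (λ i → W i % N) N
      ; head = refl
      ; unique = Unique.applyUpTo⁺₁ (λ i → W i % N) N λ {i} {j} i<j j<N eq →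
          <⇒≢ i<j (cong<⇒≡ (<-trans i<j j<N) j<N (extend-residues-N (%≡⇒cong eq)))
      ; bound = bound′
      }
      where
      bound′ : ∀ i → at fixedWord i < N
      bound′ i with i <? N
      ... | yes i<N = subst (_< N) (sym (at-applyUpTo (λ i → W i % N) i<N)) (m%n<n (W i) N)
      ... | no i≮N = subst (_< N) (sym (at-beyond fixedWord (subst (_≤ i) (sym (length-applyUpTo (λ i → W i % N) N)) (≮⇒≥ i≮N)))) z<s

    fixedWord-letters : ∀ i → cyclicAt fixedWord i ≡ W i % N
    fixedWord-letters i = trans (letters fixedWord-isWord i) (trans (at-applyUpTo (λ i → W i % N) (m%n<n i N))
      (cong⇒%≡ (cong-W (cong-sym (cong-% i)))))

    lift-fixedWord : ∀ i → lift fixedWord i ≡ W i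
    lift-fixedWord = slow-unique (lift-N-slow fixedWord-isWord) extend-slow
      (λ i → cong-trans (lift≈letter fixedWord-isWord i) (cong-trans (cong-reflexive (fixedWord-letters i)) (cong-sym (cong-% (W i)))))
      (lift-zero fixedWord-isWord)

    fixedWord-isFixed : IsFixed fixedWord
    fixedWord-isFixed = record
      { word = fixedWord-isWord
      -- Over N positions a lift rises by N times the number of cyclic descents, whereas the winding
      -- rises by c N.
      ; descents = *-cancelʳ-≡ (cycDes fixedWord) c N (begin
          cycDes fixedWord * N    ≡⟨ lift-N fixedWord-isWord ⟨
          lift fixedWord N        ≡⟨ lift-fixedWord N ⟩
          W N                     ≡⟨ cong W (*-identityˡ N) ⟨
          W (1 * N)               ≡⟨ full-turns 0 1 ⟩
          1 * c * N               ≡⟨ cong (_* N) (*-identityˡ c) ⟩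
          c * N                   ∎)
      ; rotation = e , subst (e <_) (sym l) (m%n<n (c⁻¹ * n) N) , at-ext (trans (length-rotate e fixedWord) (sym (length-map (λ a → (a + n) % N) fixedWord))) turn
      }
      where
      open ≡-Reasoning
      e : ℕ
      -- The rotation must bring a position with letter n to the front. Since W (c⁻¹ n) = c⁻¹ c n ≡
      -- n modulo N, the position c⁻¹ n, reduced modulo N, is the right one.
      e = (c⁻¹ * n) % N
      l : length fixedWord ≡ N
      l = len fixedWord-isWord
      turned : ∀ i → Cong N (W (i + e)) (W i % N + n)
      turned i = cong-trans (cong-W {i + e} {i + c⁻¹ * n} (cong-+ (cong-reflexive refl) (cong-sym (cong-% (c⁻¹ * n)))))
        (cong-trans (cong-reflexive (trans (extend-periodic* i c⁻¹) (cong (λ u → W i + u * (c * n)) (sym (*-identityˡ c⁻¹)))))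
          (cong-+ (cong-% (W i)) (cong-trans (cong-c⁻¹ 1) (cong-reflexive (*-identityˡ n)))))
      turn : ∀ {i} → i < length (rotate e fixedWord) → at (rotate e fixedWord) i ≡ at (shiftWord n N fixedWord) i
      turn {i} i< = begin
        at (rotate e fixedWord) i                     ≡⟨ at-rotate {e} {fixedWord} (subst (e <_) (sym l) (m%n<n (c⁻¹ * n) N)) i<l ⟩
        at fixedWord ((i + e) % length fixedWord)     ≡⟨ cyclicAt-% fixedWord refl (i + e) ⟨
        cyclicAt fixedWord (i + e)                    ≡⟨ fixedWord-letters (i + e) ⟩
        W (i + e) % N                                 ≡⟨ cong⇒%≡ (turned i) ⟩
        (W i % N + n) % N                             ≡⟨ cong (λ u → (u + n) % N) (at-applyUpTo (λ i → W i % N) (subst (i <_) l i<l)) ⟨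
        (at fixedWord i + n) % N                      ≡⟨ at-shiftWord n N fixedWord i<l ⟨
        at (shiftWord n N fixedWord) i                ∎
        where
        i<l : i < length fixedWord
        i<l = subst (i <_) (length-rotate e fixedWord) i<

  extend-injective : ∀ {rq rq′} (p : rq ∈ pairs (perms (range m))) (p′ : rq′ ∈ pairs (perms (range m))) →
    fixedWord p ≡ fixedWord p′ → rq ≡ rq′
  extend-injective {rq} {rq′} p p′ eq = position-injective n (|r| p) (|q| p) (r< p) (|r| p′) (|q| p′) (r< p′) λ {i} i≤m →
    let i≤n = m≤n⇒m≤1+n i≤m in begin
      position n rq i           ≡⟨ extend-position p i≤n ⟨
      extend rq i               ≡⟨ lift-fixedWord p i ⟨
      lift (fixedWord p) i      ≡⟨ cong (λ w → lift w i) eq ⟩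
      lift (fixedWord p′) i     ≡⟨ lift-fixedWord p′ i ⟩
      extend rq′ i              ≡⟨ extend-position p′ i≤n ⟩
      position n rq′ i          ∎
    where open ≡-Reasoning

  |fixedWords|≡alcoves : length fixedWords ≡ alcoves
  |fixedWords|≡alcoves = ≤-antisym
    (injection⇒length≤ alcove unique-fixedWords (alcove∈pairs ∘ ∈-fixedWords⁻)
      λ w∈ w′∈ → alcove-injective (∈-fixedWords⁻ w∈) (∈-fixedWords⁻ w′∈))
    -- `fixedWord` takes a membership proof as argument, whereas an injection acts on the bare pair;
    -- so the underlying word is written out.
    (injection⇒length≤ (λ rq → applyUpTo (λ i → extend rq i % N) N)
      (unique-pairs (unique-perms (range m) (sorted⇒unique (sorted-range m))))
      (∈-fixedWords⁺ ∘ fixedWord-isFixed) extend-injective)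

theorem4p3 : (n c d : ℕ) → .{{_ : NonZero d}} →
    0 < n → 0 < c → gcd c d ≡ 1 → c < d * n →
    IsNormalizedVolume n c d ((ℤ.+ refinedEulerian (d * n ∸ 1) (c ∸ 1) d) ℚ./ 1)
theorem4p3 (suc m) (suc k) d@(suc d′) 0<n 0<c coprime c<N =
  subst (λ V → IsNormalizedVolume (suc m) (suc k) d ((ℤ.+ V) ℚ./ 1)) (sym count) (Volume.normalizedVolume (suc k) d m)
  where
  -- With this form `suc M` is `d * suc m` by computation, so the equation required by
  -- `Correspondence` is `refl`. Only the shift `suc M / d` has to be rewritten to `suc m`.
  M : ℕ
  M = m + d′ * suc m
  fixedBy : ℕ → List (List ℕ)
  fixedBy s = filterᵇ (λ w → (cycDes w ≡ᵇ suc k) ∧ sameCirc (shiftWord s (suc M) w) w) (circPerms M)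
  count : refinedEulerian M k d ≡ Volume.alcoves (suc k) d m
  count = trans (cong (length ∘ fixedBy) (trans (cong (_/ d) (*-comm d (suc m))) (m*n/n≡m (suc m) d)))
    (Correspondence.|fixedWords|≡alcoves (suc k) d m M refl 0<c c<N coprime)
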